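{- For all integers $n>1$, \[ \frac{p(n-1)}{p(n)}\left(1+\frac{1}{n}\right) > \frac{p(n)}{p(n+1)}. \]
   Context: $p(n)$ denotes the number of integer partitions of $n$ (with $p(0)=1$). -}

module Defs where

open import Data.Nat using (ℕ; zero; suc; _+_; _∸_; _≤ᵇ_)
open import Data.List using (List; []; _∷_; map; concatMap; length; upTo)
open import Data.Bool using (if_then_else_)

-- An integer partition of n is a non-increasing list of positive parts summing to n.
-- partitionsBounded n m enumerates (each exactly once) the non-increasing lists of
-- positive integers, all parts ≤ m, summing to n: the first (largest) part k ranges
-- over 1..n with k ≤ m, followed by a partition of n ∸ k with parts ≤ k.
-- The first argument is fuel (≥ n suffices, since each step removes a part ≥ 1).
partitionsBounded′ : ℕ → ℕ → ℕ → List (List ℕ)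
partitionsBounded′ fuel       zero    m = [] ∷ []
partitionsBounded′ zero       (suc n) m = []
partitionsBounded′ (suc fuel) (suc n) m =
  concatMap
    (λ i → if suc i ≤ᵇ m
           then map (suc i ∷_) (partitionsBounded′ fuel (n ∸ i) (suc i))
           else [])
    (upTo (suc n))

-- all partitions of n (fuel n, largest part ≤ n, which is no restriction)
partitions : ℕ → List (List ℕ)
partitions n = partitionsBounded′ n n n

p : ℕ → ℕ
p n = length (partitions n)

{-# OPTIONS --safe #-}

-- The claim says that n! p(n) is strictly log-convex.  It is proved by strong induction, starting from a
-- computation for n ≤ 1400.  Write a = p(n-1), N = p(n), b = N - a.  The identity
-- n p(n) = Σ_{i,j ≥ 1} j p(n - ij) at n + 1, n and n - 1 combines into
--
--   a ((n+1) p(n+1) a - n N²) = a N² + Σ_{i,j ≥ 1} j Q(n - ij),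
--   Q(m) = p(m+1) a² - 2 p(m) a N + p(m-1) N².
--
-- For i = 1 the inner sum is a²N + b²S₁ - b(N + a)S₀ with S₀ = Σ_{t<n} p(t) and S₁ = Σ_j j p(n - j).
-- Convexity of p gives (2S₀ + N)² ≤ N (6S₁ + N) (Cauchy–Schwarz for the second differences), so that
-- aN² plus this part is at least about aN²/2.  For i ≥ 2 the induction hypothesis bounds the discriminant
-- of Q(m), whence Q(m) ≥ -2aN p(m)/(2m + 1).  Convexity also shows that stride i contributes at most a
-- fraction 1/i² of stride 1 to the sum for n p(n), so i ≥ 2 accounts for at most 2/5 of it, because
-- Σ_{i≥2} 1/i² ≤ 2/3.  Thus the loss is about (2/5) aN² < aN²/2.  The rest of the work is to control the
-- weights 1/(2m + 1) against 1/(2n + 1), for which p(m) must decay fast enough below n.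

module Submission where

open import Defs
open import Data.Bool using (Bool; true; false; if_then_else_; T; _∧_; _∨_)
open import Data.Bool.Properties using (T-∧; T-∨; T-≡)
open import Data.Empty using (⊥)
open import Data.List using (List; []; _∷_; _++_; _ʳ++_; map; concatMap; length; applyUpTo; take; drop; replicate)
open import Data.List.Properties using (length-++; length-map)
open import Data.Nat
open import Data.Nat.Divisibility using (_∣_; m∣m*n; ∣-trans; m≤n⇒m!∣n!)
open import Data.Nat.DivMod using (_/_; m*[n/m]≡n)
open import Data.Nat.Induction using (<-rec)
open import Data.Nat.Properties
open import Data.Nat.Tactic.RingSolver using (solve-∀)
open import Data.Product using (∃; _×_; _,_; proj₁; proj₂)
open import Data.Sum using (inj₁; inj₂)
open import Function using (id; _∘_; Equivalence)
open import Relation.Binary.PropositionalEquality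
open import Relation.Nullary using (yes; no; contradiction)

-- Finite sums

-- The margin is thin, and this shapes the constants. The remainder Nb² with b ≤ a lowers the
-- guaranteed gain from 1/2 to 23/48 of aN². The strides i ≥ 2 would cost 2/5 if every weight were
-- 1/(2n + 1). But Q(m) brings 1/(2m + 1) with m = n - ij, and 2n + 1 = (2m + 1) + 2ij turns the
-- excess into a further sum with weights j · ij. That sum costs another 1/20, and comparing its
-- strides with the full sum of squares costs 1/60. In the limit the loss is 7/15 < 23/48; the long
-- finite computation pays for the lower-order terms. The decay of p below n is not taken from
-- asymptotics: Cauchy-Schwarz bounds Σ_{t<n} p(t) by a multiple of √n p(n), and a bootstrap carries
-- a weaker bound over to e(m)/(2m + 1). Everything stays in ℕ: negative terms change sides, (2n +
-- 1)! clears denominators, and arguments below 0 are truncated, so sequences are arranged to vanish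
-- at 0.

∑ : ℕ → (ℕ → ℕ) → ℕ
∑ zero    f = 0
∑ (suc n) f = ∑ n f + f n

infixl 8 _²
_² : ℕ → ℕ
x ² = x * x

+-interchange : ∀ a b c d → (a + b) + (c + d) ≡ (a + c) + (b + d)
+-interchange = solve-∀

∑-cong : ∀ n {f g : ℕ → ℕ} → (∀ k → k < n → f k ≡ g k) → ∑ n f ≡ ∑ n g
∑-cong zero    eq = refl
∑-cong (suc n) eq = cong₂ _+_ (∑-cong n (λ k k<n → eq k (m<n⇒m<1+n k<n))) (eq n ≤-refl)

∑-mono : ∀ n {f g : ℕ → ℕ} → (∀ k → k < n → f k ≤ g k) → ∑ n f ≤ ∑ n g
∑-mono zero    le = z≤n
∑-mono (suc n) le = +-mono-≤ (∑-mono n (λ k k<n → le k (m<n⇒m<1+n k<n))) (le n ≤-refl)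

∑-+ : ∀ n (f g : ℕ → ℕ) → ∑ n (λ k → f k + g k) ≡ ∑ n f + ∑ n g
∑-+ zero    f g = refl
∑-+ (suc n) f g = trans (cong (_+ (f n + g n)) (∑-+ n f g)) (+-interchange (∑ n f) (∑ n g) (f n) (g n))

∑-* : ∀ c n (f : ℕ → ℕ) → ∑ n (λ k → c * f k) ≡ c * ∑ n f
∑-* c zero    f = sym (*-zeroʳ c)
∑-* c (suc n) f = trans (cong (_+ c * f n) (∑-* c n f)) (sym (*-distribˡ-+ c (∑ n f) (f n)))

∑-const : ∀ n c → ∑ n (λ _ → c) ≡ n * c
∑-const zero    c = refl
∑-const (suc n) c = trans (cong (_+ c) (∑-const n c)) (+-comm (n * c) c)

∑-zero : ∀ n {f : ℕ → ℕ} → (∀ k → k < n → f k ≡ 0) → ∑ n f ≡ 0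
∑-zero n eq = trans (∑-cong n eq) (trans (∑-const n 0) (*-zeroʳ n))

∑-head : ∀ n (f : ℕ → ℕ) → ∑ (suc n) f ≡ f 0 + ∑ n (λ k → f (suc k))
∑-head zero    f = +-comm 0 (f 0)
∑-head (suc n) f = trans (cong (_+ f (suc n)) (∑-head n f)) (+-assoc (f 0) _ (f (suc n)))

∑-swap : ∀ m n (f : ℕ → ℕ → ℕ) → ∑ m (λ i → ∑ n (f i)) ≡ ∑ n (λ j → ∑ m (λ i → f i j))
∑-swap zero    n f = sym (∑-zero n (λ _ _ → refl))
∑-swap (suc m) n f = trans (cong (_+ ∑ n (f m)) (∑-swap m n f)) (sym (∑-+ n (λ j → ∑ m (λ i → f i j)) (f m)))

∑-++ : ∀ m n (f : ℕ → ℕ) → ∑ (m + n) f ≡ ∑ m f + ∑ n (λ k → f (m + k))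
∑-++ m zero    f = trans (cong (λ z → ∑ z f) (+-identityʳ m)) (sym (+-identityʳ (∑ m f)))
∑-++ m (suc n) f = trans (cong (λ z → ∑ z f) (+-suc m n))
  (trans (cong (_+ f (m + n)) (∑-++ m n f)) (+-assoc (∑ m f) _ (f (m + n))))

∑-extend : ∀ {m n} {f : ℕ → ℕ} → m ≤ n → (∀ k → m ≤ k → f k ≡ 0) → ∑ n f ≡ ∑ m f
∑-extend {m} {n} {f} m≤n zs = begin
  ∑ n f                                       ≡⟨ cong (λ z → ∑ z f) (sym (m+[n∸m]≡n m≤n)) ⟩
  ∑ (m + (n ∸ m)) f                           ≡⟨ ∑-++ m (n ∸ m) f ⟩
  ∑ m f + ∑ (n ∸ m) (λ k → f (m + k))         ≡⟨ cong (∑ m f +_) (∑-zero (n ∸ m) (λ k _ → zs (m + k) (m≤m+n m k))) ⟩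
  ∑ m f + 0                                   ≡⟨ +-identityʳ (∑ m f) ⟩
  ∑ m f                                       ∎
  where open ≡-Reasoning

-- ∑∑ x n = Σ_{k<n} (k+1) x(n-1-k), and ∑∑∑ x n has weights (k+2 choose 2) instead.
∑∑ ∑∑∑ : (ℕ → ℕ) → ℕ → ℕ
∑∑  x n = ∑ (suc n) (λ t → ∑ t x)
∑∑∑ x n = ∑ (suc n) (∑∑ x)

∑-reverse : ∀ n (x : ℕ → ℕ) → ∑ n (λ k → x (n ∸ suc k)) ≡ ∑ n x
∑-reverse zero    x = refl
∑-reverse (suc n) x = trans (∑-head n (λ k → x (suc n ∸ suc k)))
  (trans (cong (x n +_) (∑-reverse n x)) (+-comm (x n) (∑ n x)))

∑∑-weighted : ∀ n (x : ℕ → ℕ) → ∑ n (λ k → suc k * x (n ∸ suc k)) ≡ ∑∑ x n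
∑∑-weighted zero    x = refl
∑∑-weighted (suc n) x = begin
  ∑ (suc n) (λ k → suc k * x (n ∸ k))
    ≡⟨ ∑-+ (suc n) (λ k → x (n ∸ k)) (λ k → k * x (n ∸ k)) ⟩
  ∑ (suc n) (λ k → x (n ∸ k)) + ∑ (suc n) (λ k → k * x (n ∸ k))
    ≡⟨ cong₂ _+_ (∑-reverse (suc n) x) (trans (∑-head n (λ k → k * x (n ∸ k))) (∑∑-weighted n x)) ⟩
  ∑ (suc n) x + ∑∑ x n
    ≡⟨ +-comm (∑ (suc n) x) (∑∑ x n) ⟩
  ∑∑ x (suc n) ∎
  where open ≡-Reasoning

-- Because (k+1)² = 2 (k+2 choose 2) - (k+1).
∑∑∑-weighted : ∀ n (x : ℕ → ℕ) →
  ∑ n (λ k → suc k ² * x (n ∸ suc k)) + ∑∑ x n ≡ 2 * ∑∑∑ x n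
∑∑∑-weighted zero    x = refl
∑∑∑-weighted (suc n) x = begin
  ∑ (suc n) (λ k → suc k ² * x (n ∸ k)) + ∑∑ x (suc n)
    ≡⟨ cong (_+ ∑∑ x (suc n)) sq ⟩
  (∑ n (λ k → suc k ² * x (n ∸ suc k)) + 2 * ∑∑ x n + ∑ (suc n) x) + ∑∑ x (suc n)
    ≡⟨ ring₁ (∑ n (λ k → suc k ² * x (n ∸ suc k))) (∑∑ x n) (∑ (suc n) x) ⟩
  (∑ n (λ k → suc k ² * x (n ∸ suc k)) + ∑∑ x n) + 2 * ∑∑ x (suc n)
    ≡⟨ cong (_+ 2 * ∑∑ x (suc n)) (∑∑∑-weighted n x) ⟩
  2 * ∑∑∑ x n + 2 * ∑∑ x (suc n)
    ≡⟨ sym (*-distribˡ-+ 2 (∑∑∑ x n) (∑∑ x (suc n))) ⟩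
  2 * ∑∑∑ x (suc n) ∎
  where
  open ≡-Reasoning
  ring₁ : ∀ q d s → (q + 2 * d + s) + (d + s) ≡ (q + d) + 2 * (d + s)
  ring₁ = solve-∀
  ring₂ : ∀ k y → suc k * suc k * y ≡ (k * k * y + 2 * (k * y)) + y
  ring₂ = solve-∀
  sq : ∑ (suc n) (λ k → suc k ² * x (n ∸ k)) ≡ ∑ n (λ k → suc k ² * x (n ∸ suc k)) + 2 * ∑∑ x n + ∑ (suc n) x
  sq = begin
    ∑ (suc n) (λ k → suc k ² * x (n ∸ k))
      ≡⟨ ∑-cong (suc n) (λ k _ → ring₂ k (x (n ∸ k))) ⟩
    ∑ (suc n) (λ k → (k * k * x (n ∸ k) + 2 * (k * x (n ∸ k))) + x (n ∸ k))
      ≡⟨ ∑-+ (suc n) _ _ ⟩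
    ∑ (suc n) (λ k → k * k * x (n ∸ k) + 2 * (k * x (n ∸ k))) + ∑ (suc n) (λ k → x (n ∸ k))
      ≡⟨ cong₂ _+_ (∑-+ (suc n) _ _) (∑-reverse (suc n) x) ⟩
    ∑ (suc n) (λ k → k * k * x (n ∸ k)) + ∑ (suc n) (λ k → 2 * (k * x (n ∸ k))) + ∑ (suc n) x
      ≡⟨ cong (_+ ∑ (suc n) x) (cong₂ _+_ (∑-head n (λ k → k * k * x (n ∸ k)))
           (trans (∑-* 2 (suc n) (λ k → k * x (n ∸ k)))
             (cong (2 *_) (trans (∑-head n (λ k → k * x (n ∸ k))) (∑∑-weighted n x))))) ⟩
    ∑ n (λ k → suc k ² * x (n ∸ suc k)) + 2 * ∑∑ x n + ∑ (suc n) x ∎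

-- Counting partitions

length-concatMap-applyUpTo : ∀ {X : Set} (h : ℕ → List X) (g : ℕ → ℕ) k →
  length (concatMap h (applyUpTo g k)) ≡ ∑ k (λ i → length (h (g i)))
length-concatMap-applyUpTo h g zero    = refl
length-concatMap-applyUpTo h g (suc k) = trans (length-++ (h (g 0)))
  (trans (cong (length (h (g 0)) +_) (length-concatMap-applyUpTo h (g ∘ suc) k))
         (sym (∑-head k (λ i → length (h (g i))))))

length-if : ∀ {X : Set} (b : Bool) (xs : List X) →
  length (if b then xs else []) ≡ (if b then length xs else 0)
length-if true  xs = refl
length-if false xs = refl

countWithFuel : ℕ → ℕ → ℕ → ℕ
countWithFuel fuel n m = length (partitionsBounded′ fuel n m)

countWithFuel-suc : ∀ fuel n m → countWithFuel (suc fuel) (suc n) m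
  ≡ ∑ (suc n) (λ i → if suc i ≤ᵇ m then countWithFuel fuel (n ∸ i) (suc i) else 0)
countWithFuel-suc fuel n m = trans (length-concatMap-applyUpTo h id (suc n))
  (∑-cong (suc n) (λ i _ → trans (length-if (suc i ≤ᵇ m) (extended i))
    (cong (λ z → if suc i ≤ᵇ m then z else 0) (length-map (suc i ∷_) (partitionsBounded′ fuel (n ∸ i) (suc i))))))
  where
  extended h : ℕ → List (List ℕ)
  extended i = map (suc i ∷_) (partitionsBounded′ fuel (n ∸ i) (suc i))
  h i = if suc i ≤ᵇ m then extended i else []

countWithFuel-irrelevant : ∀ f g n m → n ≤ f → n ≤ g → countWithFuel f n m ≡ countWithFuel g n m
countWithFuel-irrelevant f g zero m _ _ = refl
countWithFuel-irrelevant (suc f) (suc g) (suc n) m (s≤s n≤f) (s≤s n≤g) =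
  trans (countWithFuel-suc f n m) (trans
    (∑-cong (suc n) (λ i _ → cong (λ z → if suc i ≤ᵇ m then z else 0)
      (countWithFuel-irrelevant f g (n ∸ i) (suc i) (≤-trans (m∸n≤m n i) n≤f) (≤-trans (m∸n≤m n i) n≤g))))
    (sym (countWithFuel-suc g n m)))

count : ℕ → ℕ → ℕ
count m n = countWithFuel n n m

-- Sequences are shifted by one, with value 0 at 0, so that truncated subtraction extends them by zero.
shift : (ℕ → ℕ) → ℕ → ℕ
shift x zero    = 0
shift x (suc n) = x n

shift-∸≡0 : ∀ x {m n} → m ≤ n → shift x (m ∸ n) ≡ 0
shift-∸≡0 x m≤n = cong (shift x) (m≤n⇒m∸n≡0 m≤n)

count-suc : ∀ m n → count m (suc n) ≡ ∑ (suc n) (λ i → if suc i ≤ᵇ m then count (suc i) (n ∸ i) else 0)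
count-suc m n = trans (countWithFuel-suc n n m) (∑-cong (suc n) (λ i _ →
  cong (λ z → if suc i ≤ᵇ m then z else 0) (countWithFuel-irrelevant n (n ∸ i) (n ∸ i) (suc i) (m∸n≤m n i) ≤-refl)))

if-zero : ∀ (b : Bool) {x} → x ≡ 0 → (if b then x else 0) ≡ 0
if-zero true  eq = eq
if-zero false eq = refl

if-≤ᵇ-true : ∀ {i m} (x : ℕ) → i ≤ m → (if i ≤ᵇ m then x else 0) ≡ x
if-≤ᵇ-true {i} {m} x i≤m with i ≤ᵇ m | ≤⇒≤ᵇ i≤m
... | true | _ = refl

if-≤ᵇ-false : ∀ {i m} (x : ℕ) → m < i → (if i ≤ᵇ m then x else 0) ≡ 0
if-≤ᵇ-false {i} {m} x m<i with i ≤ᵇ m in eq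
... | false = refl
... | true  = contradiction (≤ᵇ⇒≤ i m (subst T (sym eq) _)) (<⇒≱ m<i)

count-by-largest-part : ∀ m n → count m (suc n) ≡ ∑ m (λ i → shift (count (suc i)) (suc n ∸ i))
count-by-largest-part m n = begin
  count m (suc n)                 ≡⟨ count-suc m n ⟩
  ∑ (suc n) (λ i → if suc i ≤ᵇ m then count (suc i) (n ∸ i) else 0)
    ≡⟨ ∑-cong (suc n) (λ i i≤n → cong (λ z → if suc i ≤ᵇ m then z else 0)
         (sym (cong (shift (count (suc i))) (+-∸-assoc 1 (≤-pred i≤n))))) ⟩
  -- The range passes from n + 1 to m through the common extension n + 1 + m: beyond n the terms
  -- vanish by truncation, beyond m by the test in `u`.
  ∑ (suc n) u                     ≡⟨ sym (∑-extend (m≤m+n (suc n) m) (λ k n<k → if-zero (suc k ≤ᵇ m) (shift-∸≡0 (count (suc k)) n<k))) ⟩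
  ∑ (suc n + m) u                 ≡⟨ ∑-extend (m≤n+m m (suc n)) (λ k m≤k → if-≤ᵇ-false (t k) (s≤s m≤k)) ⟩
  ∑ m u                           ≡⟨ ∑-cong m (λ k k<m → if-≤ᵇ-true (t k) k<m) ⟩
  ∑ m t                           ∎
  where
  open ≡-Reasoning
  t u : ℕ → ℕ
  t i = shift (count (suc i)) (suc n ∸ i)
  u i = if suc i ≤ᵇ m then t i else 0

-- The last summand of `count-by-largest-part` has largest part m + 1, one copy of which is removed.
-- On generating functions this is multiplication by 1/(1 - q^(m+1)).
count-rec : ∀ m x → shift (count (suc m)) x ≡ shift (count m) x + shift (count (suc m)) (x ∸ suc m)
count-rec m zero          = refl
count-rec m (suc zero)    = cong (1 +_) (sym (shift-∸≡0 (count (suc m)) {0} {m} z≤n))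
count-rec m (suc (suc n)) = trans (count-by-largest-part (suc m) n)
  (cong (_+ shift (count (suc m)) (suc n ∸ m)) (sym (count-by-largest-part m n)))

count-stable : ∀ m n → n ≤ m → count m n ≡ p n
count-stable m n n≤m with m ≤? n
... | yes m≤n = cong (λ z → count z n) (≤-antisym m≤n n≤m)
count-stable zero    n n≤m | no m≰n = contradiction z≤n m≰n
count-stable (suc m) n n≤m | no m≰n = trans (count-rec m (suc n))
  (trans (cong (count m n +_) (shift-∸≡0 (count (suc m)) (≤-pred (≰⇒> m≰n))))
         (trans (+-identityʳ (count m n)) (count-stable m n (≤-pred (≰⇒> m≰n)))))

shift-stable : ∀ m x → x ≤ suc m → shift (count m) x ≡ shift p x
shift-stable m zero    _         = refl
shift-stable m (suc x) (s≤s x≤m) = count-stable m x x≤m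

∸-swap : ∀ x a b → (x ∸ a) ∸ b ≡ (x ∸ b) ∸ a
∸-swap x a b = trans (∸-+-assoc x a b) (trans (cong (x ∸_) (+-comm a b)) (sym (∸-+-assoc x b a)))

-- The divisor sum identity

module WeightIdentity (M : ℕ) where

  -- For `x = count m` and 1 ≤ d ≤ m this is the total multiplicity of the part d in the partitions
  -- of n - 1 into parts at most m; arguments are shifted by one. The cutoff `M` is harmless once n
  -- ≤ M.
  stride : (ℕ → ℕ) → ℕ → ℕ → ℕ
  stride x d n = ∑ M (λ i → shift x (n ∸ suc i * d))

  stride-rec : ∀ m d n → stride (count (suc m)) d n
    ≡ stride (count m) d n + stride (count (suc m)) d (n ∸ suc m)
  stride-rec m d n = trans
    (∑-cong M (λ i _ → trans (count-rec m (n ∸ suc i * d))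
      (cong (λ z → shift (count m) (n ∸ suc i * d) + shift (count (suc m)) z) (∸-swap n (suc i * d) (suc m)))))
    (∑-+ M _ _)

  stride-unroll : ∀ x d n → n ≤ M → stride x (suc d) n ≡ shift x (n ∸ suc d) + stride x (suc d) (n ∸ suc d)
  stride-unroll x d n n≤M = begin
    ∑ M (λ i → shift x (n ∸ suc i * suc d))
      ≡⟨ sym (∑-extend (n≤1+n M) (λ k M≤k → shift-∸≡0 x (≤-trans n≤M (≤-trans M≤k (≤-trans (n≤1+n k) (m≤m*n (suc k) (suc d))))))) ⟩
    ∑ (suc M) (λ i → shift x (n ∸ suc i * suc d))
      ≡⟨ ∑-head M _ ⟩
    shift x (n ∸ 1 * suc d) + ∑ M (λ i → shift x (n ∸ suc (suc i) * suc d))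
      ≡⟨ cong₂ _+_ (cong (λ z → shift x (n ∸ z)) (*-identityˡ (suc d)))
           (∑-cong M (λ i _ → cong (shift x) (sym (∸-+-assoc n (suc d) (suc i * suc d))))) ⟩
    shift x (n ∸ suc d) + stride x (suc d) (n ∸ suc d) ∎
    where open ≡-Reasoning

  weight : ℕ → ℕ → ℕ
  weight m n = ∑ m (λ j → suc j * stride (count m) (suc j) n)

  weight-rec : ∀ m n → n ≤ M → weight (suc m) n
    ≡ weight m n + weight (suc m) (n ∸ suc m) + suc m * shift (count (suc m)) (n ∸ suc m)
  weight-rec m n n≤M = begin
    ∑ m (λ j → suc j * stride (count (suc m)) (suc j) n) + suc m * stride (count (suc m)) (suc m) n
      ≡⟨ cong₂ _+_ (trans (∑-cong m (λ j _ → trans (cong (suc j *_) (stride-rec m (suc j) n)) (*-distribˡ-+ (suc j) (stride (count m) (suc j) n) _))) (∑-+ m _ _))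
                   (trans (cong (suc m *_) (stride-unroll (count (suc m)) m n n≤M)) (*-distribˡ-+ (suc m) (shift (count (suc m)) (n ∸ suc m)) _)) ⟩
    (weight m n + rest) + (suc m * shift (count (suc m)) (n ∸ suc m) + suc m * stride (count (suc m)) (suc m) (n ∸ suc m))
      ≡⟨ ring (weight m n) rest _ _ ⟩
    weight m n + weight (suc m) (n ∸ suc m) + suc m * shift (count (suc m)) (n ∸ suc m) ∎
    where
    open ≡-Reasoning
    rest : ℕ
    rest = ∑ m (λ j → suc j * stride (count (suc m)) (suc j) (n ∸ suc m))
    ring : ∀ a b c d → (a + b) + (c + d) ≡ a + (b + d) + c
    ring = solve-∀

  -- The removed part m + 1 and the remaining size add up to n - 1. If the subtraction truncates to
  -- 0, the factor `shift` makes both sides vanish.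
  pred-weight : ∀ m n → pred (n ∸ suc m) * shift (count (suc m)) (n ∸ suc m) + suc m * shift (count (suc m)) (n ∸ suc m)
    ≡ pred n * shift (count (suc m)) (n ∸ suc m)
  pred-weight m n with n ∸ suc m in eq
  ... | zero  = trans (*-zeroʳ (suc m)) (sym (*-zeroʳ (pred n)))
  ... | suc y = trans (sym (*-distribʳ-+ (count (suc m) y) y (suc m))) (cong (_* count (suc m) y) y+m)
    where
    y+m : y + suc m ≡ pred n
    y+m = sym (cong pred (trans (sym (m∸n+n≡m {n} {suc m} (<⇒≤ (m∸n≢0⇒n<m (λ e → contradiction (trans (sym eq) e) (λ ()))))))
                                (cong (_+ suc m) eq)))

  -- Both sides are the sum of all parts of all partitions of n - 1 into parts at most m. The proof
  -- needs no bijection: `weight-rec` and `count-rec` give both sides the same recurrence, by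
  -- induction on m and strong induction on n.
  weight-identity : ∀ m n → n ≤ M → weight m n ≡ pred n * shift (count m) n
  weight-identity zero zero          _ = refl
  weight-identity zero (suc zero)    _ = refl
  weight-identity zero (suc (suc n)) _ = sym (trans (cong (suc n *_) (count-by-largest-part 0 n)) (*-zeroʳ (suc n)))
  weight-identity (suc m) = <-rec (λ n → n ≤ M → weight (suc m) n ≡ pred n * shift (count (suc m)) n) step
    where
    open ≡-Reasoning
    step : ∀ n → (∀ {k} → k < n → k ≤ M → weight (suc m) k ≡ pred k * shift (count (suc m)) k) →
           n ≤ M → weight (suc m) n ≡ pred n * shift (count (suc m)) n
    step zero    _   _   = ∑-zero (suc m) (λ j _ → trans (cong (suc j *_) (∑-zero M (λ i _ → shift-∸≡0 (count (suc m)) {0} {suc i * suc j} z≤n))) (*-zeroʳ (suc j)))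
    step (suc n) rec n≤M = begin
      weight (suc m) (suc n)
        ≡⟨ weight-rec m (suc n) n≤M ⟩
      weight m (suc n) + weight (suc m) (n ∸ m) + suc m * shift (count (suc m)) (n ∸ m)
        ≡⟨ cong₂ (λ u v → u + v + suc m * shift (count (suc m)) (n ∸ m)) (weight-identity m (suc n) n≤M)
             (rec (s≤s (m∸n≤m n m)) (≤-trans (m∸n≤m n m) (≤-trans (n≤1+n n) n≤M))) ⟩
      n * count m n + pred (n ∸ m) * shift (count (suc m)) (n ∸ m) + suc m * shift (count (suc m)) (n ∸ m)
        ≡⟨ +-assoc (n * count m n) _ _ ⟩
      n * count m n + (pred (n ∸ m) * shift (count (suc m)) (n ∸ m) + suc m * shift (count (suc m)) (n ∸ m))
        ≡⟨ cong (n * count m n +_) (pred-weight m (suc n)) ⟩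
      n * count m n + n * shift (count (suc m)) (n ∸ m)
        ≡⟨ sym (*-distribˡ-+ n (count m n) _) ⟩
      n * (count m n + shift (count (suc m)) (n ∸ m))
        ≡⟨ cong (n *_) (sym (count-rec m (suc n))) ⟩
      n * count (suc m) n ∎

-- The part j occurs at least i times in p(n - ij) partitions of n.
divisor-sum-identity : ∀ M n → suc n ≤ M →
  n * p n ≡ ∑ M (λ i → ∑ M (λ j → suc j * shift p (suc n ∸ suc i * suc j)))
divisor-sum-identity M n n<M = begin
  n * p n
    ≡⟨ cong (n *_) (sym (count-stable M n (<⇒≤ n<M))) ⟩
  n * count M n
    ≡⟨ sym (weight-identity M (suc n) n<M) ⟩
  ∑ M (λ j → suc j * ∑ M (λ i → shift (count M) (suc n ∸ suc i * suc j)))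
    ≡⟨ ∑-cong M (λ j _ → trans (sym (∑-* (suc j) M _)) (∑-cong M (λ i _ →
         cong (suc j *_) (shift-stable M _ (≤-trans (m∸n≤m (suc n) (suc i * suc j)) (m≤n⇒m≤1+n n<M)))))) ⟩
  ∑ M (λ j → ∑ M (λ i → suc j * shift p (suc n ∸ suc i * suc j)))
    ≡⟨ ∑-swap M M _ ⟩
  ∑ M (λ i → ∑ M (λ j → suc j * shift p (suc n ∸ suc i * suc j))) ∎
  where
  open ≡-Reasoning
  open WeightIdentity M

-- First differences of p

count-one : ∀ n → count 1 n ≡ 1
count-one zero    = refl
count-one (suc n) = trans (count-rec 0 (2 + n)) (trans (cong₂ _+_ (count-by-largest-part 0 n) (count-one n)) refl)

-- The part 1 is available, so a partition can be enlarged by 1. In the recursion both summands of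
-- `count-rec` are monotone, starting from the constant `count 1`.
count-mono : ∀ m n → shift (count (suc m)) n ≤ shift (count (suc m)) (suc n)
count-mono m       zero    = z≤n
count-mono zero    (suc n) = ≤-reflexive (trans (count-one n) (sym (count-one (suc n))))
count-mono (suc m) (suc n) = <-rec (λ n → shift (count (2 + m)) n ≤ shift (count (2 + m)) (suc n)) step (suc n)
  where
  step : ∀ n → (∀ {k} → k < n → shift (count (2 + m)) k ≤ shift (count (2 + m)) (suc k)) →
         shift (count (2 + m)) n ≤ shift (count (2 + m)) (suc n)
  step zero    rec = z≤n
  step (suc n) rec = subst₂ _≤_ (sym (count-rec (suc m) (suc n))) (sym (count-rec (suc m) (2 + n)))
    (+-mono-≤ (count-mono m (suc n)) lagged)
    where
    lagged : shift (count (2 + m)) (n ∸ suc m) ≤ shift (count (2 + m)) (n ∸ m)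
    lagged with n ≤? m
    ... | yes n≤m = subst (_≤ shift (count (2 + m)) (n ∸ m)) (sym (shift-∸≡0 (count (2 + m)) (m≤n⇒m≤1+n n≤m))) z≤n
    ... | no  n≰m = subst (λ z → shift (count (2 + m)) (n ∸ suc m) ≤ shift (count (2 + m)) z)
      (sym (+-∸-assoc 1 (≰⇒> n≰m))) (rec (s≤s (m∸n≤m n (suc m))))

count-mono-≤ : ∀ m {k n} → k ≤ n → shift (count (suc m)) k ≤ shift (count (suc m)) n
count-mono-≤ m k≤n = help (≤⇒≤′ k≤n)
  where
  help : ∀ {k n} → k ≤′ n → shift (count (suc m)) k ≤ shift (count (suc m)) n
  help (≤′-reflexive refl)      = ≤-refl
  help (≤′-step {n} k≤n)        = ≤-trans (help k≤n) (count-mono m n)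

-- For n ≥ 1, the number of partitions of n + 1 whose two largest parts are equal: either all parts
-- are 1, or k + 2 occurs twice on top. In this form every summand is monotone in n, which is the
-- convexity of p.
increment : ℕ → ℕ
increment n = 1 + ∑ n (λ k → shift (count (2 + k)) (n ∸ 2 * suc k))

increment-mono : ∀ n → increment n ≤ increment (suc n)
increment-mono n = s≤s (≤-trans
  (∑-mono n (λ k _ → count-mono-≤ (suc k) (∸-monoˡ-≤ (2 * suc k) (n≤1+n n)))) (m≤m+n _ _))

-- p with its value at 0 replaced by 0: this makes the sequence convex from the start.
e : ℕ → ℕ
e zero    = 0
e (suc n) = p (suc n)

-- Removing the largest part k + 2 of a partition of n + 2, or k + 1 of one of n + 1, leaves n - k,
-- split into parts ≤ k + 2 or ≤ k + 1 respectively: the difference counts a second part k + 2.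
p-suc : ∀ n → p (2 + n) ≡ p (suc n) + increment (suc n)
p-suc n = begin
  p (2 + n)
    ≡⟨ count-by-largest-part (2 + n) (suc n) ⟩
  ∑ (2 + n) (λ i → shift (count (suc i)) (2 + n ∸ i))
    ≡⟨ ∑-head (suc n) _ ⟩
  count 1 (suc n) + ∑ (suc n) (λ i → shift (count (2 + i)) (suc n ∸ i))
    ≡⟨ cong₂ _+_ (count-one (suc n)) (trans (∑-cong (suc n) (λ i _ → trans (count-rec (suc i) (suc n ∸ i))
         (cong (λ z → shift (count (suc i)) (suc n ∸ i) + shift (count (2 + i)) z) (idx i)))) (∑-+ (suc n) _ _)) ⟩
  1 + (∑ (suc n) (λ i → shift (count (suc i)) (suc n ∸ i)) + ∑ (suc n) (λ i → shift (count (2 + i)) (suc n ∸ 2 * suc i)))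
    ≡⟨ cong (λ z → 1 + (z + ∑ (suc n) (λ i → shift (count (2 + i)) (suc n ∸ 2 * suc i)))) (sym (count-by-largest-part (suc n) n)) ⟩
  1 + (p (suc n) + ∑ (suc n) (λ i → shift (count (2 + i)) (suc n ∸ 2 * suc i)))
    ≡⟨ sym (+-suc (p (suc n)) _) ⟩
  p (suc n) + increment (suc n) ∎
  where
  open ≡-Reasoning
  ring : ∀ i → i + (2 + i) ≡ 2 * suc i
  ring = solve-∀
  idx : ∀ i → (suc n ∸ i) ∸ (2 + i) ≡ suc n ∸ 2 * suc i
  idx i = trans (∸-+-assoc (suc n) i (2 + i)) (cong (suc n ∸_) (ring i))

e-suc : ∀ n → e (suc n) ≡ e n + increment n
e-suc zero    = refl
e-suc (suc n) = p-suc n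

-- Convexity

2xy≤x²+y² : ∀ x y → 2 * (x * y) ≤ x ² + y ²
2xy≤x²+y² x y with ≤-total x y
... | inj₁ x≤y = subst (λ z → 2 * (x * z) ≤ x ² + z ²) (m+[n∸m]≡n x≤y)
  (subst (2 * (x * (x + (y ∸ x))) ≤_) (ring x (y ∸ x)) (m≤m+n _ ((y ∸ x) ²)))
  where
  ring : ∀ x d → 2 * (x * (x + d)) + d * d ≡ x * x + (x + d) * (x + d)
  ring = solve-∀
... | inj₂ y≤x = subst (λ z → 2 * (z * y) ≤ z ² + y ²) (m+[n∸m]≡n y≤x)
  (subst (2 * ((y + (x ∸ y)) * y) ≤_) (ring y (x ∸ y)) (m≤m+n _ ((x ∸ y) ²)))
  where
  ring : ∀ y d → 2 * ((y + d) * y) + d * d ≡ (y + d) * (y + d) + y * y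
  ring = solve-∀

-- The moments m_r = Σ_l c_l l^r of a nonnegative weight satisfy Cauchy–Schwarz.  For the second
-- differences c of a convex sequence, translating l to l + 1 and adding a new weight at l = 1
-- amounts to appending a term to the sequence.
record CauchySchwarz (m₀ m₁ m₂ m₃ : ℕ) : Set where
  constructor cauchySchwarz
  field
    m₁²≤m₀m₂  : m₁ ² ≤ m₀ * m₂
    m₁m₂≤m₀m₃ : m₁ * m₂ ≤ m₀ * m₃
    m₂²≤m₁m₃  : m₂ ² ≤ m₁ * m₃

CauchySchwarz-step : ∀ {m₀ m₁ m₂ m₃} c → CauchySchwarz m₀ m₁ m₂ m₃ →
  CauchySchwarz (m₀ + c) (m₁ + m₀ + c) (m₂ + 2 * m₁ + m₀ + c) (m₃ + 3 * m₂ + 3 * m₁ + m₀ + c)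
-- Each new inequality is a nonnegative combination of the old ones plus multiples of c; `k₁`, `k₂`,
-- `k₃` collect what the two sides share.
CauchySchwarz-step {m₀} {m₁} {m₂} {m₃} c (cauchySchwarz i₁ i₂ i₃) = cauchySchwarz
  (subst₂ _≤_ (l₁ m₀ m₁ c) (r₁ m₀ m₁ m₂ c) (+-mono-≤ i₁ (m≤m+n (k₁ m₀ m₁ c) (c * m₂))))
  (subst₂ _≤_ (l₂ m₀ m₁ m₂ c) (r₂ m₀ m₁ m₂ m₃ c)
    (+-mono-≤ (+-mono-≤ i₂ (*-monoʳ-≤ 2 i₁)) (m≤m+n (k₂ m₀ m₁ m₂ c) (c * (m₃ + 2 * m₂)))))
  (subst₂ _≤_ (l₃ m₀ m₁ m₂ c) (r₃ m₀ m₁ m₂ m₃ c)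
    (+-mono-≤ (+-mono-≤ (+-mono-≤ i₃ i₂) i₁) (m≤m+n (k₃ m₀ m₁ m₂ c) (c * (m₃ + m₂)))))
  where
  k₁ : ℕ → ℕ → ℕ → ℕ
  k₁ m₀ m₁ c = m₀ * m₀ + c * c + 2 * (m₁ * m₀) + 2 * (m₁ * c) + 2 * (m₀ * c)
  k₂ k₃ : ℕ → ℕ → ℕ → ℕ → ℕ
  k₂ m₀ m₁ m₂ c = m₁ * m₀ + m₁ * c + m₀ * m₂ + 2 * (m₀ * m₁) + m₀ * m₀ + m₀ * c + c * m₂ + 2 * (c * m₁) + c * m₀ + c * c
  k₃ m₀ m₁ m₂ c = 3 * (m₁ * m₁) + m₀ * m₀ + c * c + 3 * (m₁ * m₂) + 2 * (m₀ * m₂) + 2 * (m₂ * c) + 4 * (m₁ * m₀) + 4 * (m₁ * c) + 2 * (m₀ * c)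
  l₁ : ∀ m₀ m₁ c → m₁ * m₁ + (m₀ * m₀ + c * c + 2 * (m₁ * m₀) + 2 * (m₁ * c) + 2 * (m₀ * c)) ≡ (m₁ + m₀ + c) * (m₁ + m₀ + c)
  l₁ = solve-∀
  r₁ : ∀ m₀ m₁ m₂ c → m₀ * m₂ + ((m₀ * m₀ + c * c + 2 * (m₁ * m₀) + 2 * (m₁ * c) + 2 * (m₀ * c)) + c * m₂) ≡ (m₀ + c) * (m₂ + 2 * m₁ + m₀ + c)
  r₁ = solve-∀
  l₂ : ∀ m₀ m₁ m₂ c → (m₁ * m₂ + 2 * (m₁ * m₁)) + (m₁ * m₀ + m₁ * c + m₀ * m₂ + 2 * (m₀ * m₁) + m₀ * m₀ + m₀ * c + c * m₂ + 2 * (c * m₁) + c * m₀ + c * c)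
     ≡ (m₁ + m₀ + c) * (m₂ + 2 * m₁ + m₀ + c)
  l₂ = solve-∀
  r₂ : ∀ m₀ m₁ m₂ m₃ c → (m₀ * m₃ + 2 * (m₀ * m₂)) + ((m₁ * m₀ + m₁ * c + m₀ * m₂ + 2 * (m₀ * m₁) + m₀ * m₀ + m₀ * c + c * m₂ + 2 * (c * m₁) + c * m₀ + c * c) + c * (m₃ + 2 * m₂))
     ≡ (m₀ + c) * (m₃ + 3 * m₂ + 3 * m₁ + m₀ + c)
  r₂ = solve-∀
  l₃ : ∀ m₀ m₁ m₂ c → ((m₂ * m₂ + m₁ * m₂) + m₁ * m₁) + (3 * (m₁ * m₁) + m₀ * m₀ + c * c + 3 * (m₁ * m₂) + 2 * (m₀ * m₂) + 2 * (m₂ * c) + 4 * (m₁ * m₀) + 4 * (m₁ * c) + 2 * (m₀ * c))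
     ≡ (m₂ + 2 * m₁ + m₀ + c) * (m₂ + 2 * m₁ + m₀ + c)
  l₃ = solve-∀
  r₃ : ∀ m₀ m₁ m₂ m₃ c → ((m₁ * m₃ + m₀ * m₃) + m₀ * m₂) + ((3 * (m₁ * m₁) + m₀ * m₀ + c * c + 3 * (m₁ * m₂) + 2 * (m₀ * m₂) + 2 * (m₂ * c) + 4 * (m₁ * m₀) + 4 * (m₁ * c) + 2 * (m₀ * c)) + c * (m₃ + m₂))
     ≡ (m₁ + m₀ + c) * (m₃ + 3 * m₂ + 3 * m₁ + m₀ + c)
  r₃ = solve-∀

-- Since l² = 2 (l choose 2) + l and l³ = 6 (l+1 choose 3) + l, the second and third moments become
-- iterated partial sums of p. The new weight is the second difference of p, and the start at n = 2
-- is checked numerically, which takes care of p(0) = 1.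
p-CauchySchwarz : ∀ k → CauchySchwarz (increment (suc k)) (p (2 + k))
  (2 * ∑ (2 + k) p + p (2 + k)) (6 * ∑∑ p (2 + k) + p (2 + k))
p-CauchySchwarz zero    = cauchySchwarz (≤ᵇ⇒≤ 4 6 _) (≤ᵇ⇒≤ 12 20 _) (≤ᵇ⇒≤ 36 40 _)
p-CauchySchwarz (suc k) = subst-all (CauchySchwarz-step c (p-CauchySchwarz k))
  where
  i c N S S₂ : ℕ
  i = increment (suc k)
  c = increment (2 + k) ∸ i
  N = p (2 + k)
  S = ∑ (2 + k) p
  S₂ = ∑∑ p (2 + k)
  m₀≡ : i + c ≡ increment (2 + k)
  m₀≡ = m+[n∸m]≡n (increment-mono (suc k))
  m₁≡ : N + i + c ≡ p (3 + k)
  m₁≡ = trans (+-assoc N i c) (trans (cong (N +_) m₀≡) (sym (p-suc (suc k))))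
  ring₂ : ∀ i c N S → 2 * S + N + 2 * N + i + c ≡ 2 * (S + N) + (N + i + c)
  ring₂ = solve-∀
  m₂≡ : 2 * S + N + 2 * N + i + c ≡ 2 * ∑ (3 + k) p + p (3 + k)
  m₂≡ = trans (ring₂ i c N S) (cong (2 * (S + N) +_) m₁≡)
  ring₃ : ∀ i c N S S₂ → 6 * S₂ + N + 3 * (2 * S + N) + 3 * N + i + c ≡ 6 * (S₂ + (S + N)) + (N + i + c)
  ring₃ = solve-∀
  m₃≡ : 6 * S₂ + N + 3 * (2 * S + N) + 3 * N + i + c ≡ 6 * ∑∑ p (3 + k) + p (3 + k)
  m₃≡ = trans (ring₃ i c N S S₂) (cong (6 * (S₂ + (S + N)) +_) m₁≡)
  subst-all : CauchySchwarz (i + c) (N + i + c) (2 * S + N + 2 * N + i + c) (6 * S₂ + N + 3 * (2 * S + N) + 3 * N + i + c) →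
              CauchySchwarz (increment (2 + k)) (p (3 + k)) (2 * ∑ (3 + k) p + p (3 + k)) (6 * ∑∑ p (3 + k) + p (3 + k))
  subst-all h = subst₂ (λ m₀ m₁ → CauchySchwarz m₀ m₁ (2 * ∑ (3 + k) p + p (3 + k)) (6 * ∑∑ p (3 + k) + p (3 + k))) m₀≡ m₁≡ (subst₂ (CauchySchwarz (i + c) (N + i + c)) m₂≡ m₃≡ h)

p-moments : ∀ n → 2 ≤ n → (2 * ∑ n p + p n) ² ≤ p n * (6 * ∑∑ p n + p n)
p-moments (suc (suc k)) _ = CauchySchwarz.m₂²≤m₁m₃ (p-CauchySchwarz k)
p-moments (suc zero) (s≤s ())

increment-mono-≤ : ∀ {m n} → m ≤ n → increment m ≤ increment n
increment-mono-≤ m≤n = help (≤⇒≤′ m≤n)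
  where
  help : ∀ {m n} → m ≤′ n → increment m ≤ increment n
  help (≤′-reflexive refl) = ≤-refl
  help (≤′-step {n} m≤n)   = ≤-trans (help m≤n) (increment-mono n)

-- Truncated differences for i and i + 1 are either both 0 or consecutive, so a property need only
-- be checked in these two cases.
∸-suc-cases : ∀ (P : ℕ → ℕ → Set) n i → P 0 0 → (∀ k → k ≤ n → P (suc k) k) → P (n ∸ i) (n ∸ suc i)
∸-suc-cases P zero    i       P00 Ps = subst₂ P (sym (0∸n≡0 i)) refl P00
∸-suc-cases P (suc n) zero    P00 Ps = Ps n (n≤1+n n)
∸-suc-cases P (suc n) (suc i) P00 Ps = ∸-suc-cases P n i P00 (λ k k≤n → Ps k (m≤n⇒m≤1+n k≤n))

-- Convexity survives truncation, so i may exceed n: `e` starts at 0 and its differences are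
-- nonnegative and nondecreasing.
e-midpoint : ∀ n i → 2 * e n ≤ e (n + i) + e (n ∸ i)
e-midpoint n zero    rewrite +-identityʳ n | +-identityʳ (e n) = ≤-refl
e-midpoint n (suc i) = begin
  2 * e n                                           ≤⟨ e-midpoint n i ⟩
  e (n + i) + e (n ∸ i)                             ≤⟨ +-monoʳ-≤ (e (n + i)) fall ⟩
  e (n + i) + (e (n ∸ suc i) + increment (n + i))   ≡⟨ ring (e (n + i)) _ _ ⟩
  (e (n + i) + increment (n + i)) + e (n ∸ suc i)   ≡⟨ cong (_+ e (n ∸ suc i)) (sym (trans (cong e (+-suc n i)) (e-suc (n + i)))) ⟩
  e (n + suc i) + e (n ∸ suc i)                     ∎
  where
  open ≤-Reasoning
  ring : ∀ a b c → a + (b + c) ≡ (a + c) + b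
  ring = solve-∀
  fall : e (n ∸ i) ≤ e (n ∸ suc i) + increment (n + i)
  fall = ∸-suc-cases (λ x y → e x ≤ e y + increment (n + i)) n i z≤n
    (λ k k≤n → ≤-trans (≤-reflexive (e-suc k)) (+-monoʳ-≤ (e k) (increment-mono-≤ (≤-trans k≤n (m≤m+n n i)))))

∑e-midpoint : ∀ n i → ∑ (n ∸ i) e + (1 + 2 * i) * e n ≤ ∑ (suc (n + i)) e
∑e-midpoint n zero    rewrite +-identityʳ n | +-identityʳ (e n) = ≤-refl
∑e-midpoint n (suc i) = begin
  ∑ (n ∸ suc i) e + (1 + 2 * suc i) * e n
    ≡⟨ ring₁ (∑ (n ∸ suc i) e) i (e n) ⟩
  (∑ (n ∸ suc i) e + (1 + 2 * i) * e n) + 2 * e n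
    ≤⟨ +-monoʳ-≤ (∑ (n ∸ suc i) e + (1 + 2 * i) * e n) (e-midpoint n (suc i)) ⟩
  (∑ (n ∸ suc i) e + (1 + 2 * i) * e n) + (e (n + suc i) + e (n ∸ suc i))
    ≡⟨ ring₂ (∑ (n ∸ suc i) e) ((1 + 2 * i) * e n) _ _ ⟩
  ((∑ (n ∸ suc i) e + e (n ∸ suc i)) + (1 + 2 * i) * e n) + e (n + suc i)
    ≡⟨ cong (λ z → (z + (1 + 2 * i) * e n) + e (n + suc i)) (sym peel) ⟩
  (∑ (n ∸ i) e + (1 + 2 * i) * e n) + e (n + suc i)
    ≤⟨ +-monoˡ-≤ (e (n + suc i)) (∑e-midpoint n i) ⟩
  ∑ (suc (n + i)) e + e (n + suc i)
    ≡⟨ cong (λ z → ∑ z e + e (n + suc i)) (sym (+-suc n i)) ⟩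
  ∑ (suc (n + suc i)) e ∎
  where
  open ≤-Reasoning
  ring₁ : ∀ s i x → s + (1 + 2 * suc i) * x ≡ (s + (1 + 2 * i) * x) + 2 * x
  ring₁ = solve-∀
  ring₂ : ∀ s t u v → (s + t) + (u + v) ≡ ((s + v) + t) + u
  ring₂ = solve-∀
  peel : ∑ (n ∸ i) e ≡ ∑ (n ∸ suc i) e + e (n ∸ suc i)
  peel = ∸-suc-cases (λ x y → ∑ x e ≡ ∑ y e + e y) n i refl (λ k _ → refl)

-- The unit second difference of `∑∑ e` at n is e(n). With step i it averages e against a triangular
-- kernel of mass i² centred at n, and convexity bounds this below by the central value.
∑∑e-midpoint : ∀ n i → 2 * ∑∑ e n + i ² * e n ≤ ∑∑ e (n + i) + ∑∑ e (n ∸ i)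
∑∑e-midpoint n zero    rewrite +-identityʳ n | +-identityʳ (2 * ∑∑ e n) | +-identityʳ (∑∑ e n) = ≤-refl
∑∑e-midpoint n (suc i) = begin
  2 * ∑∑ e n + suc i ² * e n
    ≡⟨ ring₁ (∑∑ e n) i (e n) ⟩
  (2 * ∑∑ e n + i ² * e n) + (1 + 2 * i) * e n
    ≤⟨ +-monoˡ-≤ _ (∑∑e-midpoint n i) ⟩
  (∑∑ e (n + i) + ∑∑ e (n ∸ i)) + (1 + 2 * i) * e n
    ≡⟨ cong (λ z → (∑∑ e (n + i) + z) + (1 + 2 * i) * e n) peel ⟩
  (∑∑ e (n + i) + (∑∑ e (n ∸ suc i) + ∑ (n ∸ i) e)) + (1 + 2 * i) * e n
    ≡⟨ ring₂ (∑∑ e (n + i)) (∑∑ e (n ∸ suc i)) _ _ ⟩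
  (∑∑ e (n + i) + (∑ (n ∸ i) e + (1 + 2 * i) * e n)) + ∑∑ e (n ∸ suc i)
    ≤⟨ +-monoˡ-≤ (∑∑ e (n ∸ suc i)) (+-monoʳ-≤ (∑∑ e (n + i)) (∑e-midpoint n i)) ⟩
  ∑∑ e (suc (n + i)) + ∑∑ e (n ∸ suc i)
    ≡⟨ cong (λ z → ∑∑ e z + ∑∑ e (n ∸ suc i)) (sym (+-suc n i)) ⟩
  ∑∑ e (n + suc i) + ∑∑ e (n ∸ suc i) ∎
  where
  open ≤-Reasoning
  ring₁ : ∀ f i x → 2 * f + suc i * suc i * x ≡ (2 * f + i * i * x) + (1 + 2 * i) * x
  ring₁ = solve-∀
  ring₂ : ∀ a b c d → (a + (b + c)) + d ≡ (a + (c + d)) + b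
  ring₂ = solve-∀
  peel : ∑∑ e (n ∸ i) ≡ ∑∑ e (n ∸ suc i) + ∑ (n ∸ i) e
  peel = ∸-suc-cases (λ x y → ∑∑ e x ≡ ∑∑ e y + ∑ x e) n i refl (λ k _ → refl)

-- Strided sums of a convex sequence

module Stride (M d : ℕ) .{{_ : NonZero d}} where

  stride-sum : (ℕ → ℕ) → ℕ → ℕ
  stride-sum w n = ∑ M (λ j → w j * e (n ∸ d * suc j))

  stride-sum-small : ∀ w n → n ≤ d → stride-sum w n ≡ 0
  stride-sum-small w n n≤d = ∑-zero M (λ j _ →
    trans (cong (λ z → w j * e z) (m≤n⇒m∸n≡0 (≤-trans n≤d (m≤m*n d (suc j))))) (*-zeroʳ (w j)))

  stride-sum-+ : ∀ w n → n ≤ M → stride-sum w (n + d) ≡ w 0 * e n + stride-sum (w ∘ suc) n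
  stride-sum-+ w n n≤M = begin
    ∑ M (λ j → w j * e (n + d ∸ d * suc j))
      ≡⟨ sym (∑-extend (n≤1+n M) (λ k M≤k → trans (cong (λ z → w k * e z) (trans (index k) (m≤n⇒m∸n≡0
           (≤-trans (≤-trans n≤M M≤k) (m≤n*m k d))))) (*-zeroʳ (w k)))) ⟩
    ∑ (suc M) (λ j → w j * e (n + d ∸ d * suc j))
      ≡⟨ ∑-head M _ ⟩
    w 0 * e (n + d ∸ d * 1) + ∑ M (λ j → w (suc j) * e (n + d ∸ d * suc (suc j)))
      ≡⟨ cong₂ _+_ (cong (λ z → w 0 * e z) (trans (index 0) (cong (n ∸_) (*-zeroʳ d))))
           (∑-cong M (λ j _ → cong (λ z → w (suc j) * e z) (index (suc j)))) ⟩
    w 0 * e n + stride-sum (w ∘ suc) n ∎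
    where
    open ≡-Reasoning
    index : ∀ j → n + d ∸ d * suc j ≡ n ∸ d * j
    index j = trans (cong₂ _∸_ (+-comm n d) (*-suc d j)) ([m+n]∸[m+o]≡n∸o d n (d * j))

  -- With F = `∑∑ e`, the first component says d² Σ_j e(n - dj) ≤ F(n) - F(n - d). It passes from n
  -- - d to n by `∑∑e-midpoint`, and adding it up along n, n - d, n - 2d, ... telescopes to the
  -- second.
  Bounds : ℕ → Set
  Bounds n = d ² * stride-sum (λ _ → 1) n + ∑∑ e (n ∸ d) ≤ ∑∑ e n × d ² * stride-sum suc n ≤ ∑∑ e n

  bounds : ∀ n → n ≤ M → Bounds n
  bounds = <-rec (λ n → n ≤ M → Bounds n) step
    where
    step : ∀ n → (∀ {k} → k < n → k ≤ M → Bounds k) → n ≤ M → Bounds n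
    step n rec n≤M with n ≤? d
    ... | yes n≤d rewrite stride-sum-small (λ _ → 1) n n≤d | stride-sum-small suc n n≤d | *-zeroʳ (d ²) | m≤n⇒m∸n≡0 n≤d = z≤n , z≤n
    ... | no  n≰d = subst Bounds k+d≡n (first , second)
      where
      open ≤-Reasoning
      k : ℕ
      k = n ∸ d
      k+d≡n : k + d ≡ n
      k+d≡n = m∸n+n≡m (<⇒≤ (≰⇒> n≰d))
      k<n : k < n
      k<n = subst (k <_) k+d≡n (m<m+n k (>-nonZero⁻¹ d))
      k≤M : k ≤ M
      k≤M = ≤-trans (<⇒≤ k<n) n≤M
      ih : Bounds k
      ih = rec k<n k≤M
      ring₁ : ∀ q x l f g → (q * (x + l) + f) + (f + g) ≡ (q * l + g) + (2 * f + q * x)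
      ring₁ = solve-∀
      ring₂ : ∀ f g h → f + (h + g) ≡ h + (f + g)
      ring₂ = solve-∀
      L g : ℕ
      L = stride-sum (λ _ → 1) k
      g = stride-sum suc k
      L+ : stride-sum (λ _ → 1) (k + d) ≡ e k + L
      L+ = trans (stride-sum-+ (λ _ → 1) k k≤M) (cong (_+ L) (+-identityʳ (e k)))
      g+ : stride-sum suc (k + d) ≡ (e k + L) + g
      g+ = trans (stride-sum-+ suc k k≤M) (trans (cong₂ _+_ (+-identityʳ (e k))
        (trans (∑-cong M (λ j _ → cong (_+ suc j * e (k ∸ d * suc j)) (sym (+-identityʳ (e (k ∸ d * suc j)))))) (∑-+ M _ _)))
        (sym (+-assoc (e k) L g)))
      first′ : d ² * (e k + L) + ∑∑ e k ≤ ∑∑ e (k + d)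
      first′ = +-cancelʳ-≤ (∑∑ e k + ∑∑ e (k ∸ d)) _ _ (begin
        (d ² * (e k + L) + ∑∑ e k) + (∑∑ e k + ∑∑ e (k ∸ d))
          ≡⟨ ring₁ (d ²) (e k) L (∑∑ e k) (∑∑ e (k ∸ d)) ⟩
        (d ² * L + ∑∑ e (k ∸ d)) + (2 * ∑∑ e k + d ² * e k)
          ≤⟨ +-mono-≤ (proj₁ ih) (∑∑e-midpoint k d) ⟩
        ∑∑ e k + (∑∑ e (k + d) + ∑∑ e (k ∸ d))
          ≡⟨ ring₂ (∑∑ e k) (∑∑ e (k ∸ d)) (∑∑ e (k + d)) ⟩
        ∑∑ e (k + d) + (∑∑ e k + ∑∑ e (k ∸ d)) ∎)
      first : d ² * stride-sum (λ _ → 1) (k + d) + ∑∑ e (k + d ∸ d) ≤ ∑∑ e (k + d)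
      first = subst₂ (λ u v → d ² * u + ∑∑ e v ≤ ∑∑ e (k + d)) (sym L+) (sym (m+n∸n≡m k d)) first′
      second : d ² * stride-sum suc (k + d) ≤ ∑∑ e (k + d)
      second = begin
        d ² * stride-sum suc (k + d)       ≡⟨ trans (cong (d ² *_) g+) (*-distribˡ-+ (d ²) (e k + L) g) ⟩
        d ² * (e k + L) + d ² * g          ≤⟨ +-monoʳ-≤ (d ² * (e k + L)) (proj₂ ih) ⟩
        d ² * (e k + L) + ∑∑ e k           ≤⟨ first′ ⟩
        ∑∑ e (k + d)                       ∎

strided-e-bound : ∀ M i n → n ≤ M → suc i ² * ∑ M (λ j → suc j * e (n ∸ suc i * suc j)) ≤ ∑∑ e n
strided-e-bound M i n n≤M = proj₂ (Stride.bounds M (suc i) n n≤M)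

-- By telescoping 1/i² ≤ 2/(2i-1) - 2/(2i+1).
basel : ∀ k X (x : ℕ → ℕ) → (∀ i → i < k → (2 + i) ² * x i ≤ X) → 3 * ∑ k x ≤ 2 * X
basel k X x h = *-cancelˡ-≤ (3 + 2 * k) (≤-trans (≤-trans (≤-reflexive (ring₀ k (∑ k x))) (m≤m+n _ (6 * X))) (≤-trans (telescoped k h) (≤-reflexive (ring₁ k X))))
  where
  open ≤-Reasoning
  ring₀ : ∀ k s → (3 + 2 * k) * (3 * s) ≡ 3 * (3 + 2 * k) * s
  ring₀ = solve-∀
  ring₁ : ∀ k s → 2 * (3 + 2 * k) * s ≡ (3 + 2 * k) * (2 * s)
  ring₁ = solve-∀
  -- Divided by 2k + 3 the claim is 3Σ ≤ 2X - 6X/(2k + 3), which keeps the tail of the telescoping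
  -- sum.
  telescoped : ∀ k → (∀ i → i < k → (2 + i) ² * x i ≤ X) → 3 * (3 + 2 * k) * ∑ k x + 6 * X ≤ 2 * (3 + 2 * k) * X
  telescoped zero    h = ≤-refl
  telescoped (suc k) h = *-cancelˡ-≤ (3 + 2 * k) (+-cancelʳ-≤ ((5 + 2 * k) * (6 * X)) _ _ (begin
    (3 + 2 * k) * (3 * (3 + 2 * suc k) * (∑ k x + x k) + 6 * X) + (5 + 2 * k) * (6 * X)
      ≤⟨ +-monoˡ-≤ ((5 + 2 * k) * (6 * X)) (m≤m+n ((3 + 2 * k) * (3 * (3 + 2 * suc k) * (∑ k x + x k) + 6 * X)) (3 * x k)) ⟩
    ((3 + 2 * k) * (3 * (3 + 2 * suc k) * (∑ k x + x k) + 6 * X) + 3 * x k) + (5 + 2 * k) * (6 * X)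
      ≡⟨ ring₃ k (∑ k x) (x k) X ⟩
    (5 + 2 * k) * (3 * (3 + 2 * k) * ∑ k x + 6 * X) + (12 * ((2 + k) ² * x k) + (3 + 2 * k) * (6 * X))
      ≤⟨ +-mono-≤ (*-monoʳ-≤ (5 + 2 * k) (telescoped k (λ i i<k → h i (m<n⇒m<1+n i<k))))
           (+-monoˡ-≤ ((3 + 2 * k) * (6 * X)) (*-monoʳ-≤ 12 (h k ≤-refl))) ⟩
    (5 + 2 * k) * (2 * (3 + 2 * k) * X) + (12 * X + (3 + 2 * k) * (6 * X))
      ≡⟨ ring₄ k X ⟩
    (3 + 2 * k) * (2 * (3 + 2 * suc k) * X) + (5 + 2 * k) * (6 * X) ∎))
    where
    ring₃ : ∀ k s y X → ((3 + 2 * k) * (3 * (3 + 2 * suc k) * (s + y) + 6 * X) + 3 * y) + (5 + 2 * k) * (6 * X)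
          ≡ (5 + 2 * k) * (3 * (3 + 2 * k) * s + 6 * X) + (12 * ((2 + k) * (2 + k) * y) + (3 + 2 * k) * (6 * X))
    ring₃ = solve-∀
    ring₄ : ∀ k X → (5 + 2 * k) * (2 * (3 + 2 * k) * X) + (12 * X + (3 + 2 * k) * (6 * X)) ≡ (3 + 2 * k) * (2 * (3 + 2 * suc k) * X) + (5 + 2 * k) * (6 * X)
    ring₄ = solve-∀

-- `basel` is applied to the truncated excess of x over Y; Y itself is then paid once per term.
basel-shifted : ∀ k X Y (x : ℕ → ℕ) → (∀ i → i < k → (2 + i) ² * x i ≤ X + (2 + i) ² * Y) →
  3 * ∑ k x ≤ 2 * X + 3 * (k * Y)
basel-shifted k X Y x h = begin
  3 * ∑ k x                               ≤⟨ *-monoʳ-≤ 3 (∑-mono k (λ i _ → m≤n+m∸n (x i) Y)) ⟩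
  3 * ∑ k (λ i → Y + (x i ∸ Y))           ≡⟨ cong (3 *_) (trans (∑-+ k (λ _ → Y) _) (cong (_+ ∑ k (λ i → x i ∸ Y)) (∑-const k Y))) ⟩
  3 * (k * Y + ∑ k (λ i → x i ∸ Y))       ≡⟨ trans (*-distribˡ-+ 3 (k * Y) _) (+-comm (3 * (k * Y)) _) ⟩
  3 * ∑ k (λ i → x i ∸ Y) + 3 * (k * Y)   ≤⟨ +-monoˡ-≤ (3 * (k * Y)) (basel k X (λ i → x i ∸ Y) (λ i i<k → begin
       (2 + i) ² * (x i ∸ Y)              ≡⟨ *-distribˡ-∸ ((2 + i) ²) (x i) Y ⟩
       (2 + i) ² * x i ∸ (2 + i) ² * Y    ≤⟨ ∸-monoˡ-≤ ((2 + i) ² * Y) (h i i<k) ⟩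
       X + (2 + i) ² * Y ∸ (2 + i) ² * Y  ≡⟨ m+n∸n≡m X ((2 + i) ² * Y) ⟩
       X                                  ∎)) ⟩
  2 * X + 3 * (k * Y) ∎
  where open ≤-Reasoning

-- 2i³J² ≤ Σ (3k² + i²) over the block i(J-1) < k ≤ iJ.
strided-square-bound : ∀ i M (v : ℕ → ℕ) → (∀ k → v (suc k) ≤ v k) →
  2 * i ² * ∑ M (λ j → suc j * (i * suc j) * v (i * suc j)) ≤ ∑ (i * M) (λ k → (3 * suc k ² + i ²) * v (suc k))
strided-square-bound i zero    v dec = ≤-trans (≤-reflexive (*-zeroʳ (2 * i ²))) z≤n
strided-square-bound i (suc M) v dec = begin
  2 * i ² * (∑ M (λ j → suc j * (i * suc j) * v (i * suc j)) + suc M * (i * suc M) * v (i * suc M))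
    ≡⟨ *-distribˡ-+ (2 * i ²) _ _ ⟩
  2 * i ² * ∑ M (λ j → suc j * (i * suc j) * v (i * suc j)) + 2 * i ² * (suc M * (i * suc M) * v (i * suc M))
    ≤⟨ +-mono-≤ (strided-square-bound i M v dec) last-block ⟩
  ∑ (i * M) (λ k → (3 * suc k ² + i ²) * v (suc k)) + ∑ i (λ f → (3 * suc (i * M + f) ² + i ²) * v (suc (i * M + f)))
    ≡⟨ sym (∑-++ (i * M) i (λ k → (3 * suc k ² + i ²) * v (suc k))) ⟩
  ∑ (i * M + i) (λ k → (3 * suc k ² + i ²) * v (suc k))
    ≡⟨ cong (λ z → ∑ z (λ k → (3 * suc k ² + i ²) * v (suc k))) (trans (+-comm (i * M) i) (sym (*-suc i M))) ⟩
  ∑ (i * suc M) (λ k → (3 * suc k ² + i ²) * v (suc k)) ∎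
  where
  open ≤-Reasoning
  v-antitone : ∀ {a b} → a ≤ b → v b ≤ v a
  v-antitone a≤b = help (≤⇒≤′ a≤b)
    where
    help : ∀ {a b} → a ≤′ b → v b ≤ v a
    help (≤′-reflexive refl) = ≤-refl
    help (≤′-step {b} a≤b)   = ≤-trans (dec b) (help a≤b)
  cubes : ∀ c t → (c + t) * (c + t) * (c + t) ≤ ∑ t (λ f → 3 * suc (c + f) ²) + c * c * c
  cubes c zero    rewrite +-identityʳ c = ≤-refl
  cubes c (suc t) = begin
    (c + suc t) * (c + suc t) * (c + suc t)                                         ≡⟨ cong (λ z → z * z * z) (+-suc c t) ⟩
    suc (c + t) * suc (c + t) * suc (c + t)                                         ≤⟨ m≤m+n _ (3 * (c + t) + 2) ⟩
    suc (c + t) * suc (c + t) * suc (c + t) + (3 * (c + t) + 2)                     ≡⟨ ring (c + t) ⟩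
    (c + t) * (c + t) * (c + t) + 3 * suc (c + t) ²                                 ≤⟨ +-monoˡ-≤ (3 * suc (c + t) ²) (cubes c t) ⟩
    ∑ t (λ f → 3 * suc (c + f) ²) + c * c * c + 3 * suc (c + t) ²                   ≡⟨ ring′ (∑ t (λ f → 3 * suc (c + f) ²)) (c * c * c) (3 * suc (c + t) ²) ⟩
    ∑ t (λ f → 3 * suc (c + f) ²) + 3 * suc (c + t) ² + c * c * c                   ∎
    where
    ring : ∀ x → suc x * suc x * suc x + (3 * x + 2) ≡ x * x * x + 3 * (suc x * suc x)
    ring = solve-∀
    ring′ : ∀ a b c → a + b + c ≡ a + c + b
    ring′ = solve-∀
  -- With J = M + 1, after division by i³ and with 3k² ≥ k³ - (k-1)³, this needs 2J² ≤ J³ - (J-1)³ +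
  -- 1, that is M ≤ M².
  total : 2 * i ² * (suc M * (i * suc M)) ≤ ∑ i (λ f → 3 * suc (i * M + f) ² + i ²)
  total = +-cancelʳ-≤ (i * M * (i * M) * (i * M)) _ _ (begin
    2 * i ² * (suc M * (i * suc M)) + i * M * (i * M) * (i * M)
      ≤⟨ M²≥M ⟩
    (i * M + i) * (i * M + i) * (i * M + i) + i * i ²
      ≤⟨ +-monoˡ-≤ (i * i ²) (cubes (i * M) i) ⟩
    ∑ i (λ f → 3 * suc (i * M + f) ²) + i * M * (i * M) * (i * M) + i * i ²
      ≡⟨ ring′ (∑ i (λ f → 3 * suc (i * M + f) ²)) (i * M * (i * M) * (i * M)) (i * i ²) ⟩
    (∑ i (λ f → 3 * suc (i * M + f) ²) + i * i ²) + i * M * (i * M) * (i * M)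
      ≡⟨ cong (_+ i * M * (i * M) * (i * M)) (sym (trans (∑-+ i _ (λ _ → i ²)) (cong (∑ i (λ f → 3 * suc (i * M + f) ²) +_) (∑-const i (i ²))))) ⟩
    ∑ i (λ f → 3 * suc (i * M + f) ² + i ²) + i * M * (i * M) * (i * M) ∎)
    where
    ring′ : ∀ a b c → a + b + c ≡ (a + c) + b
    ring′ = solve-∀
    ring₁ : ∀ i M → 2 * (i * i) * (suc M * (i * suc M)) + i * M * (i * M) * (i * M) + i * i * i * (M * M) ≡ (i * M + i) * (i * M + i) * (i * M + i) + i * (i * i) + i * i * i * M
    ring₁ = solve-∀
    m≤m² : ∀ m → m ≤ m * m
    m≤m² zero    = z≤n
    m≤m² (suc m) = m≤m*n (suc m) (suc m)
    M²≥M : 2 * i ² * (suc M * (i * suc M)) + i * M * (i * M) * (i * M) ≤ (i * M + i) * (i * M + i) * (i * M + i) + i * i ²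
    M²≥M = +-cancelʳ-≤ (i * i * i * M) _ _ (≤-trans (+-monoʳ-≤ _ (*-monoʳ-≤ (i * i * i) (m≤m² M))) (≤-reflexive (ring₁ i M)))
  last-block : 2 * i ² * (suc M * (i * suc M) * v (i * suc M)) ≤ ∑ i (λ f → (3 * suc (i * M + f) ² + i ²) * v (suc (i * M + f)))
  last-block = begin
    2 * i ² * (suc M * (i * suc M) * v (i * suc M))
      ≡⟨ sym (*-assoc (2 * i ²) (suc M * (i * suc M)) (v (i * suc M))) ⟩
    2 * i ² * (suc M * (i * suc M)) * v (i * suc M)
      ≤⟨ *-monoˡ-≤ (v (i * suc M)) total ⟩
    ∑ i (λ f → 3 * suc (i * M + f) ² + i ²) * v (i * suc M)
      ≡⟨ trans (*-comm _ (v (i * suc M))) (sym (∑-* (v (i * suc M)) i _)) ⟩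
    ∑ i (λ f → v (i * suc M) * (3 * suc (i * M + f) ² + i ²))
      ≤⟨ ∑-mono i (λ f f<i → ≤-trans (≤-reflexive (*-comm (v (i * suc M)) _)) (*-monoʳ-≤ (3 * suc (i * M + f) ² + i ²)
           (v-antitone (subst (suc (i * M + f) ≤_) (trans (+-comm (i * M) i) (sym (*-suc i M)))
             (subst (_≤ i * M + i) (+-suc (i * M) f) (+-monoʳ-≤ (i * M) f<i)))))) ⟩
    ∑ i (λ f → (3 * suc (i * M + f) ² + i ²) * v (suc (i * M + f))) ∎

-- Growth of the partial sums of p

linear : ∀ x c b a → (x + c) * b + a ≡ x * b + (c * b + a)
linear = solve-∀

-- Comparison of coefficients: with t = x + 1400 it reduces an inequality for all t ≥ 1400 to three
-- numerical ones.
quadratic-≤ : ∀ k b a d c k′ b′ a′ d′ c′ x →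
  k * (a * c) ≤ k′ * (a′ * c′) → k * (b * c + a * d) ≤ k′ * (b′ * c′ + a′ * d′) → k * (b * d) ≤ k′ * (b′ * d′) →
  k * ((x * b + a) * (x * d + c)) ≤ k′ * ((x * b′ + a′) * (x * d′ + c′))
quadratic-≤ k b a d c k′ b′ a′ d′ c′ x h₀ h₁ h₂ = begin
  k * ((x * b + a) * (x * d + c))
    ≡⟨ ring k b a d c x ⟩
  k * (a * c) + k * (b * c + a * d) * x + k * (b * d) * (x * x)
    ≤⟨ +-mono-≤ (+-mono-≤ h₀ (*-monoˡ-≤ x h₁)) (*-monoˡ-≤ (x * x) h₂) ⟩
  k′ * (a′ * c′) + k′ * (b′ * c′ + a′ * d′) * x + k′ * (b′ * d′) * (x * x)
    ≡⟨ sym (ring k′ b′ a′ d′ c′ x) ⟩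
  k′ * ((x * b′ + a′) * (x * d′ + c′)) ∎
  where
  open ≤-Reasoning
  ring : ∀ k b a d c x → k * ((x * b + a) * (x * d + c)) ≡ k * (a * c) + k * (b * c + a * d) * x + k * (b * d) * (x * x)
  ring = solve-∀

p>0 : ∀ n → 0 < p n
p>0 zero          = s≤s z≤n
p>0 (suc zero)    = s≤s z≤n
p>0 (suc (suc n)) = subst (0 <_) (sym (p-suc n)) (<-≤-trans (s≤s z≤n) (m≤n+m (increment (suc n)) (p (suc n))))

∑-shift : ∀ x n → ∑ (suc n) (shift x) ≡ ∑ n x
∑-shift x n = ∑-head n (shift x)

∑∑-shift : ∀ x n → ∑∑ (shift x) (suc n) ≡ ∑∑ x n
∑∑-shift x n = trans (∑-head (suc n) (λ t → ∑ t (shift x))) (∑-cong (suc n) (λ t _ → ∑-shift x t))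

unit-stride : ∀ M n (x : ℕ → ℕ) → x 0 ≡ 0 → n ≤ M → ∑ M (λ j → suc j * x (n ∸ 1 * suc j)) ≡ ∑∑ x n
unit-stride M n x x0 n≤M = trans (∑-cong M (λ j _ → cong (λ z → suc j * x (n ∸ z)) (*-identityˡ (suc j))))
  (trans (∑-extend n≤M (λ k n≤k → trans (cong (λ z → suc k * x z) (m≤n⇒m∸n≡0 (m≤n⇒m≤1+n n≤k))) (trans (cong (suc k *_) x0) (*-zeroʳ (suc k)))))
         (∑∑-weighted n x))

-- The left side is the stride i = 1 of the divisor sum.
∑∑p≤n*p : ∀ n → ∑∑ p n ≤ n * p n
∑∑p≤n*p n = begin
  ∑∑ p n                                                                  ≡⟨ sym (∑∑-shift p n) ⟩
  ∑∑ (shift p) (suc n)                                                    ≡⟨ sym (unit-stride (suc n) (suc n) (shift p) refl ≤-refl) ⟩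
  g 0                                                                     ≤⟨ m≤m+n (g 0) _ ⟩
  g 0 + ∑ n (g ∘ suc)                                                     ≡⟨ sym (∑-head n g) ⟩
  ∑ (suc n) g                                                             ≡⟨ sym (divisor-sum-identity (suc n) n ≤-refl) ⟩
  n * p n                                                                 ∎
  where
  open ≤-Reasoning
  g : ℕ → ℕ
  g i = ∑ (suc n) (λ j → suc j * shift p (suc n ∸ suc i * suc j))

-- With Y = 2s + N the moment inequality gives Y² ≤ (6n + 1)N², and 2(l+1)YN ≤ Y² + (l+1)²N².
prefix-bound : ∀ l n → 2 ≤ n → ∑ n p * (4 * suc l) ≤ (n * 6 + l * l) * p n
prefix-bound l n 2≤n = *-cancelˡ-≤ (p n) {{>-nonZero (p>0 n)}} (+-cancelʳ-≤ (2 * suc l * (N * N)) _ _ (begin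
  N * (s * (4 * suc l)) + 2 * suc l * (N * N)             ≡⟨ ring₁ N s l ⟩
  2 * (Y * (N * suc l))                                   ≤⟨ 2xy≤x²+y² Y (N * suc l) ⟩
  Y ² + (N * suc l) ²                                     ≤⟨ +-monoˡ-≤ ((N * suc l) ²) (≤-trans (p-moments n 2≤n) (*-monoʳ-≤ N (+-monoˡ-≤ N (*-monoʳ-≤ 6 (∑∑p≤n*p n))))) ⟩
  N * (6 * (n * N) + N) + (N * suc l) ²                   ≡⟨ ring₂ n N l ⟩
  N * ((n * 6 + l * l) * N) + 2 * suc l * (N * N)         ∎))
  where
  open ≤-Reasoning
  N s Y : ℕ
  N = p n
  s = ∑ n p
  Y = 2 * s + N
  ring₁ : ∀ N s l → N * (s * (4 * suc l)) + 2 * suc l * (N * N) ≡ 2 * ((2 * s + N) * (N * suc l))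
  ring₁ = solve-∀
  ring₂ : ∀ n N l → N * (6 * (n * N) + N) + N * suc l * (N * suc l) ≡ N * ((n * 6 + l * l) * N) + 2 * suc l * (N * N)
  ring₂ = solve-∀

fourth : ℕ → ℕ
fourth x = (x * x) * (x * x)

-- One more term raises y = 6m + l² by 6; this bounds the growth factor of `fourth` by 1 + 90/y.
fourth-step : ∀ y → 6 ≤ y → fourth (y + 6) ≤ y * y * (y * (y + 90))
fourth-step y 6≤y = begin
  fourth (y + 6)                              ≤⟨ *-mono-≤ first first ⟩
  (y * (y + 18)) * (y * (y + 18))             ≡⟨ [m*n]*[o*p]≡[m*o]*[n*p] y (y + 18) y (y + 18) ⟩
  y * y * ((y + 18) * (y + 18))               ≤⟨ *-monoʳ-≤ (y * y) second ⟩
  y * y * (y * (y + 90))                      ∎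
  where
  open ≤-Reasoning
  ring₁ : ∀ y a → (y + a) * (y + a) ≡ y * (y + 2 * a) + a * a
  ring₁ = solve-∀
  ring₂ : ∀ y a b → y * (y + a) + b * y ≡ y * (y + (a + b))
  ring₂ = solve-∀
  first : (y + 6) * (y + 6) ≤ y * (y + 18)
  first = ≤-trans (≤-reflexive (ring₁ y 6)) (≤-trans (+-monoʳ-≤ (y * (y + 12)) (*-monoʳ-≤ 6 6≤y)) (≤-reflexive (ring₂ y 12 6)))
  second : (y + 18) * (y + 18) ≤ y * (y + 90)
  second = ≤-trans (≤-reflexive (ring₁ y 18)) (≤-trans (+-monoʳ-≤ (y * (y + 36)) (*-monoʳ-≤ 54 6≤y)) (≤-reflexive (ring₂ y 36 54)))

-- By `prefix-bound` the partial sum grows by a factor of at least 1 + 4(l+1)/y, where y = 6m + l²,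
-- and 4(l+1) ≥ 90 lets it keep pace with `fourth`. The fourth power is chosen to beat a cubic error
-- term in the induction step.
prefix-growth : ∀ l c → 90 ≤ 4 * suc l → 2 ≤ c → fourth (c * 6 + l * l) ≤ ∑ c p →
  ∀ x → fourth ((x + c) * 6 + l * l) ≤ ∑ (x + c) p
prefix-growth l c 90≤ 2≤c base zero    = base
prefix-growth l c 90≤ 2≤c base (suc x) = *-cancelˡ-≤ y {{>-nonZero (≤-trans (s≤s z≤n) 6≤y)}} (begin
  y * fourth (suc m * 6 + l * l)           ≡⟨ cong (λ z → y * fourth z) (ring₀ m (l * l)) ⟩
  y * fourth (y + 6)                       ≤⟨ *-monoʳ-≤ y (fourth-step y 6≤y) ⟩
  y * (y * y * (y * (y + 90)))             ≤⟨ *-monoʳ-≤ y (*-monoʳ-≤ (y * y) (*-monoʳ-≤ y (+-monoʳ-≤ y 90≤))) ⟩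
  y * (y * y * (y * (y + 4 * suc l)))      ≡⟨ ring₁ y (4 * suc l) ⟩
  (y + 4 * suc l) * fourth y               ≤⟨ *-monoʳ-≤ (y + 4 * suc l) (prefix-growth l c 90≤ 2≤c base x) ⟩
  (y + 4 * suc l) * s                      ≡⟨ ring₂ y s (4 * suc l) ⟩
  y * s + s * (4 * suc l)                  ≤⟨ +-monoʳ-≤ (y * s) (prefix-bound l m (≤-trans 2≤c (m≤n+m c x))) ⟩
  y * s + y * p m                          ≡⟨ sym (*-distribˡ-+ y s (p m)) ⟩
  y * ∑ (suc m) p                          ∎)
  where
  open ≤-Reasoning
  m y s : ℕ
  m = x + c
  y = m * 6 + l * l
  s = ∑ m p
  6≤y : 6 ≤ y
  6≤y = ≤-trans (≤-trans (m≤n+m 6 6) (*-monoˡ-≤ 6 2≤c)) (≤-trans (*-monoˡ-≤ 6 (m≤n+m c x)) (m≤m+n (m * 6) (l * l)))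
  ring₀ : ∀ m q → suc m * 6 + q ≡ (m * 6 + q) + 6
  ring₀ = solve-∀
  ring₁ : ∀ y c → y * (y * y * (y * (y + c))) ≡ (y + c) * ((y * y) * (y * y))
  ring₁ = solve-∀
  ring₂ : ∀ y s c → (y + c) * s ≡ y * s + s * c
  ring₂ = solve-∀

-- Sums weighted by 1/(2m + 1)

e≤p : ∀ n → e n ≤ p n
e≤p zero    = z≤n
e≤p (suc n) = ≤-refl

e≤n*increment : ∀ n → e n ≤ n * increment n
e≤n*increment zero    = z≤n
e≤n*increment (suc n) = begin
  e (suc n)                       ≡⟨ e-suc n ⟩
  e n + increment n               ≤⟨ +-monoˡ-≤ (increment n) (e≤n*increment n) ⟩
  n * increment n + increment n   ≡⟨ +-comm (n * increment n) (increment n) ⟩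
  suc n * increment n             ≤⟨ *-monoʳ-≤ (suc n) (increment-mono n) ⟩
  suc n * increment (suc n)       ∎
  where open ≤-Reasoning

-- V m = D e(m) / (2m + 1), where D clears the denominators for m ≤ n.
module WeightedSums (n D : ℕ) (V : ℕ → ℕ) (V-zero : V 0 ≡ 0) (V-spec : ∀ m → m ≤ n → (m * 2 + 1) * V m ≡ D * e m) where

  open ≤-Reasoning

  2m+1>0 : ∀ m → NonZero (m * 2 + 1)
  2m+1>0 m = >-nonZero (m≤n+m 1 (m * 2))

  -- By convexity e(m) is at most m times the next difference, so e grows at least linearly and
  -- dividing by 2m + 1 preserves monotonicity.
  V-mono : ∀ m → m < n → V m ≤ V (suc m)
  V-mono m m<n = *-cancelˡ-≤ (m * 2 + 1) {{2m+1>0 m}} (*-cancelˡ-≤ (suc m * 2 + 1) {{2m+1>0 (suc m)}} (begin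
    (suc m * 2 + 1) * ((m * 2 + 1) * V m)         ≡⟨ cong ((suc m * 2 + 1) *_) (V-spec m (<⇒≤ m<n)) ⟩
    (suc m * 2 + 1) * (D * e m)                   ≡⟨ ring₁ m D (e m) ⟩
    D * ((m * 2 + 1) * e m + 2 * e m)             ≤⟨ *-monoʳ-≤ D (+-monoʳ-≤ ((m * 2 + 1) * e m) (≤-trans (*-monoʳ-≤ 2 (e≤n*increment m)) (≤-trans (≤-reflexive (ring₂ m (increment m))) (m≤m+n _ (increment m))))) ⟩
    D * ((m * 2 + 1) * e m + (m * 2 * increment m + increment m)) ≡⟨ ring₃ m D (e m) (increment m) ⟩
    (m * 2 + 1) * (D * (e m + increment m))       ≡⟨ cong (λ z → (m * 2 + 1) * (D * z)) (sym (e-suc m)) ⟩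
    (m * 2 + 1) * (D * e (suc m))                 ≡⟨ cong ((m * 2 + 1) *_) (sym (V-spec (suc m) m<n)) ⟩
    (m * 2 + 1) * ((suc m * 2 + 1) * V (suc m))   ≡⟨ ring₄ (m * 2 + 1) (suc m * 2 + 1) (V (suc m)) ⟩
    (suc m * 2 + 1) * ((m * 2 + 1) * V (suc m))   ∎))
    where
    ring₁ : ∀ m D x → (suc m * 2 + 1) * (D * x) ≡ D * ((m * 2 + 1) * x + 2 * x)
    ring₁ = solve-∀
    ring₂ : ∀ m i → 2 * (m * i) ≡ m * 2 * i
    ring₂ = solve-∀
    ring₃ : ∀ m D x i → D * ((m * 2 + 1) * x + (m * 2 * i + i)) ≡ (m * 2 + 1) * (D * (x + i))
    ring₃ = solve-∀
    ring₄ : ∀ a b c → a * (b * c) ≡ b * (a * c)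
    ring₄ = solve-∀

  ∑V≤n*V : ∀ m → m ≤ n → ∑ m V ≤ m * V m
  ∑V≤n*V zero    _   = z≤n
  ∑V≤n*V (suc m) m<n = begin
    ∑ m V + V m       ≤⟨ +-monoˡ-≤ (V m) (∑V≤n*V m (<⇒≤ m<n)) ⟩
    m * V m + V m     ≡⟨ +-comm (m * V m) (V m) ⟩
    suc m * V m       ≤⟨ *-monoʳ-≤ (suc m) (V-mono m m<n) ⟩
    suc m * V (suc m) ∎

  -- In the term V(s) write 2m + 1 = (2s + 1) + 2(m - s): the first part restores D e(s), the second
  -- sums to `∑∑ V`. The next identity uses 2m + 3 = (2s + 1) + 2(m - s + 1) in the same way.
  ∑V-identity : ∀ m → m ≤ n → (m * 2 + 1) * ∑ m V ≡ D * ∑ m e + 2 * ∑∑ V m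
  ∑V-identity zero    _   = sym (trans (+-identityʳ (D * 0)) (*-zeroʳ D))
  ∑V-identity (suc m) m<n = trans (ring₁ m (∑ m V) (V m))
    (trans (cong₂ (λ u v → u + v + 2 * (∑ m V + V m)) (∑V-identity m (<⇒≤ m<n)) (V-spec m (<⇒≤ m<n)))
           (ring₂ D (∑ m e) (∑∑ V m) (e m) (∑ m V + V m)))
    where
    ring₁ : ∀ m t v → (suc m * 2 + 1) * (t + v) ≡ (m * 2 + 1) * t + (m * 2 + 1) * v + 2 * (t + v)
    ring₁ = solve-∀
    ring₂ : ∀ D s w x t → D * s + 2 * w + D * x + 2 * t ≡ D * (s + x) + 2 * (w + t)
    ring₂ = solve-∀

  ∑∑V-identity : ∀ m → m ≤ n → (m * 2 + 3) * ∑∑ V m ≡ D * ∑∑ e m + 4 * ∑∑∑ V m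
  ∑∑V-identity zero    _   = sym (trans (+-identityʳ (D * 0)) (*-zeroʳ D))
  ∑∑V-identity (suc m) m<n = trans (ring₁ m (∑∑ V m) (∑ (suc m) V))
    (trans (cong₂ (λ u v → u + v + 2 * (∑∑ V m + ∑ (suc m) V)) (∑∑V-identity m (<⇒≤ m<n)) (∑V-identity (suc m) m<n))
           (ring₂ D (∑∑ e m) (∑∑∑ V m) (∑ (suc m) e) (∑∑ V m + ∑ (suc m) V)))
    where
    ring₁ : ∀ m w t → (suc m * 2 + 3) * (w + t) ≡ (m * 2 + 3) * w + (suc m * 2 + 1) * t + 2 * (w + t)
    ring₁ = solve-∀
    ring₂ : ∀ D f q s w → D * f + 4 * q + (D * s + 2 * w) + 2 * w ≡ D * (f + s) + 4 * (q + w)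
    ring₂ = solve-∀

  module Ratio (L K : ℕ) where

    -- The decay of V below t. The bound is linear in t, weaker than the true order √t, but easy to
    -- sum again and to propagate.
    Ratio : ℕ → Set
    Ratio t = L * ∑ t V ≤ (t + K) * V t

    ∑∑V-bound : ∀ t → (∀ s → s < t → Ratio s) → L * ∑∑ V t ≤ (t + K + L) * ∑ t V
    ∑∑V-bound t ratio = begin
      L * (∑ t (λ s → ∑ s V) + ∑ t V)             ≡⟨ *-distribˡ-+ L _ (∑ t V) ⟩
      L * ∑ t (λ s → ∑ s V) + L * ∑ t V           ≡⟨ cong (_+ L * ∑ t V) (sym (∑-* L t _)) ⟩
      ∑ t (λ s → L * ∑ s V) + L * ∑ t V           ≤⟨ +-monoˡ-≤ (L * ∑ t V) (∑-mono t (λ s s<t → ≤-trans (ratio s s<t) (*-monoˡ-≤ (V s) (+-monoˡ-≤ K (<⇒≤ s<t))))) ⟩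
      ∑ t (λ s → (t + K) * V s) + L * ∑ t V       ≡⟨ cong (_+ L * ∑ t V) (∑-* (t + K) t V) ⟩
      (t + K) * ∑ t V + L * ∑ t V                 ≡⟨ sym (*-distribʳ-+ (∑ t V) (t + K) L) ⟩
      (t + K + L) * ∑ t V                         ∎

    ratio-small : ∀ t → t ≤ n → L * t ≤ t + K → Ratio t
    ratio-small t t≤n Lt≤t+K = begin
      L * ∑ t V     ≤⟨ *-monoʳ-≤ L (∑V≤n*V t t≤n) ⟩
      L * (t * V t) ≡⟨ sym (*-assoc L t (V t)) ⟩
      L * t * V t   ≤⟨ *-monoˡ-≤ (V t) Lt≤t+K ⟩
      (t + K) * V t ∎

    ratio-suc : ∀ m → suc m ≤ n → 1 ≤ m → (m + K + L) * ((suc m * 2 + 1) * p m) ≤ (suc m + K) * ((m * 2 + 1) * p (suc m)) →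
      Ratio m → Ratio (suc m)
    ratio-suc m@(suc _) m<n _ check ratio = *-cancelˡ-≤ (m * 2 + 1) {{2m+1>0 m}} (*-cancelˡ-≤ (suc m * 2 + 1) {{2m+1>0 (suc m)}} (begin
      (suc m * 2 + 1) * ((m * 2 + 1) * (L * (∑ m V + V m)))
        ≤⟨ *-monoʳ-≤ (suc m * 2 + 1) (*-monoʳ-≤ (m * 2 + 1) (≤-trans (≤-reflexive (*-distribˡ-+ L (∑ m V) (V m))) (+-monoˡ-≤ (L * V m) ratio))) ⟩
      (suc m * 2 + 1) * ((m * 2 + 1) * ((m + K) * V m + L * V m))
        ≡⟨ ring₁ (suc m * 2 + 1) (m * 2 + 1) (m + K) L (V m) ⟩
      (suc m * 2 + 1) * ((m + K + L) * ((m * 2 + 1) * V m))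
        ≡⟨ cong (λ z → (suc m * 2 + 1) * ((m + K + L) * z)) (V-spec m (<⇒≤ m<n)) ⟩
      (suc m * 2 + 1) * ((m + K + L) * (D * p m))
        ≡⟨ ring₂ (suc m * 2 + 1) (m + K + L) D (p m) ⟩
      D * ((m + K + L) * ((suc m * 2 + 1) * p m))
        ≤⟨ *-monoʳ-≤ D check ⟩
      D * ((suc m + K) * ((m * 2 + 1) * p (suc m)))
        ≡⟨ sym (ring₂ (m * 2 + 1) (suc m + K) D (p (suc m))) ⟩
      (m * 2 + 1) * ((suc m + K) * (D * p (suc m)))
        ≡⟨ cong (λ z → (m * 2 + 1) * ((suc m + K) * z)) (sym (V-spec (suc m) m<n)) ⟩
      (m * 2 + 1) * ((suc m + K) * ((suc m * 2 + 1) * V (suc m)))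
        ≡⟨ ring₃ (m * 2 + 1) (suc m * 2 + 1) (suc m + K) (V (suc m)) ⟩
      (suc m * 2 + 1) * ((m * 2 + 1) * ((suc m + K) * V (suc m))) ∎))
      where
      ring₁ : ∀ a b c L v → a * (b * (c * v + L * v)) ≡ a * ((c + L) * (b * v))
      ring₁ = solve-∀
      ring₂ : ∀ a b D x → a * (b * (D * x)) ≡ D * (b * (a * x))
      ring₂ = solve-∀
      ring₃ : ∀ a b c v → a * (c * (b * v)) ≡ b * (a * (c * v))
      ring₃ = solve-∀

    -- A bootstrap: the ratios below t bound `∑∑ V`, so in `∑V-identity` the term 2 ∑∑V absorbs only
    -- a share 2(t + K + L)/L of the factor 2t + 1. The remaining share C/L is paid by the partial
    -- sum of e, which `prefix` controls.
    ratio-large : ∀ t q E C → t ≤ n → 0 < q → 0 < C → L * (t * 2 + 1) ≡ 2 * (t + K + L) + C →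
      ∑ t e * q ≤ E * e t → L * L * (E * (t * 2 + 1)) ≤ q * (C * (t + K)) → (∀ s → s < t → Ratio s) → Ratio t
    ratio-large t q E C t≤n q>0 C>0 splitting prefix numeric ratio =
      *-cancelˡ-≤ (q * C) {{>-nonZero (*-mono-< q>0 C>0)}} (begin
        q * C * (L * S)                          ≡⟨ ring₁ q C L S ⟩
        q * L * (C * S)                          ≤⟨ *-monoʳ-≤ (q * L) bound ⟩
        q * L * (L * (D * s))                    ≡⟨ ring₂ q L D s ⟩
        L * L * (D * (s * q))                    ≤⟨ *-monoʳ-≤ (L * L) (*-monoʳ-≤ D prefix) ⟩
        L * L * (D * (E * e t))                  ≡⟨ ring₃ (L * L) D E (e t) ⟩
        L * L * (E * (D * e t))                  ≡⟨ cong (λ z → L * L * (E * z)) (sym (V-spec t t≤n)) ⟩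
        L * L * (E * ((t * 2 + 1) * V t))        ≡⟨ ring₄ (L * L) E (t * 2 + 1) (V t) ⟩
        L * L * (E * (t * 2 + 1)) * V t          ≤⟨ *-monoˡ-≤ (V t) numeric ⟩
        q * (C * (t + K)) * V t                  ≡⟨ ring₅ q C (t + K) (V t) ⟩
        q * C * ((t + K) * V t)                  ∎)
      where
      S s W : ℕ
      S = ∑ t V
      s = ∑ t e
      W = ∑∑ V t
      ring₁ : ∀ q C L S → q * C * (L * S) ≡ q * L * (C * S)
      ring₁ = solve-∀
      ring₂ : ∀ q L D s → q * L * (L * (D * s)) ≡ L * L * (D * (s * q))
      ring₂ = solve-∀
      ring₃ : ∀ a D E x → a * (D * (E * x)) ≡ a * (E * (D * x))
      ring₃ = solve-∀
      ring₄ : ∀ a b c v → a * (b * (c * v)) ≡ a * (b * c) * v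
      ring₄ = solve-∀
      ring₅ : ∀ q C a v → q * (C * a) * v ≡ q * C * (a * v)
      ring₅ = solve-∀
      ring₆ : ∀ L x w → L * (x + 2 * w) ≡ L * x + 2 * (L * w)
      ring₆ = solve-∀
      ring₇ : ∀ a x b s → a * x + 2 * (b * s) ≡ a * x + 2 * b * s
      ring₇ = solve-∀
      bound : C * S ≤ L * (D * s)
      bound = +-cancelʳ-≤ (2 * (t + K + L) * S) (C * S) (L * (D * s)) (begin
        C * S + 2 * (t + K + L) * S                ≡⟨ trans (+-comm (C * S) _) (sym (*-distribʳ-+ S (2 * (t + K + L)) C)) ⟩
        (2 * (t + K + L) + C) * S                  ≡⟨ cong (_* S) (sym splitting) ⟩
        L * (t * 2 + 1) * S                        ≡⟨ *-assoc L (t * 2 + 1) S ⟩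
        L * ((t * 2 + 1) * S)                      ≡⟨ cong (L *_) (∑V-identity t t≤n) ⟩
        L * (D * s + 2 * W)                        ≡⟨ ring₆ L (D * s) W ⟩
        L * (D * s) + 2 * (L * W)                  ≤⟨ +-monoʳ-≤ (L * (D * s)) (*-monoʳ-≤ 2 (∑∑V-bound t ratio)) ⟩
        L * (D * s) + 2 * ((t + K + L) * S)        ≡⟨ ring₇ L (D * s) (t + K + L) S ⟩
        L * (D * s) + 2 * (t + K + L) * S          ∎)

    -- The loss from strides at least two

    module LongStrides (ratio : ∀ t → t ≤ n → Ratio t) (k : ℕ) (n≤1+k : n ≤ suc k) where

      M : ℕ
      M = suc k

      S W f squares : ℕ
      S = ∑ n V
      W = ∑∑ V n
      f = ∑∑ e n
      squares = ∑ n (λ j → suc j ² * V (n ∸ suc j))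

      strided : (ℕ → ℕ) → ℕ → ℕ
      strided x d = ∑ M (λ j → suc j * x (n ∸ d * suc j))

      strided² : ℕ → ℕ
      strided² d = ∑ M (λ j → suc j * (d * suc j) * V (n ∸ d * suc j))

      Λ R Ψ : ℕ
      Λ = ∑ k (λ i → strided V (2 + i))
      R = ∑ k (λ i → strided e (2 + i))
      Ψ = ∑ k (λ i → strided² (2 + i))

      -- Replaces the weight at m = n - j by the one at n, since 2n + 1 = (2m + 1) + 2j. For j > n
      -- truncation gives V 0 = e 0 = 0.
      V-split : ∀ j → (n * 2 + 1) * V (n ∸ j) ≡ D * e (n ∸ j) + 2 * (j * V (n ∸ j))
      V-split j with j ≤? n
      ... | yes j≤n = trans (cong (λ z → (z * 2 + 1) * V (n ∸ j)) (sym (m∸n+n≡m j≤n)))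
        (trans (ring (n ∸ j) j (V (n ∸ j))) (cong (_+ 2 * (j * V (n ∸ j))) (V-spec (n ∸ j) (m∸n≤m n j))))
        where
        ring : ∀ m j v → ((m + j) * 2 + 1) * v ≡ (m * 2 + 1) * v + 2 * (j * v)
        ring = solve-∀
      ... | no  j≰n = trans (zeros (n * 2 + 1)) (sym (cong₂ (λ u v → u + 2 * v)
                        (trans (cong (λ z → D * e z) n∸j≡0) (*-zeroʳ D)) (zeros j)))
        where
        n∸j≡0 : n ∸ j ≡ 0
        n∸j≡0 = m≤n⇒m∸n≡0 (<⇒≤ (≰⇒> j≰n))
        zeros : ∀ c → c * V (n ∸ j) ≡ 0
        zeros c = trans (cong (c *_) (trans (cong V n∸j≡0) V-zero)) (*-zeroʳ c)

      strided-split : ∀ d → (n * 2 + 1) * strided V d ≡ D * strided e d + 2 * strided² d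
      strided-split d = begin-equality
        (n * 2 + 1) * strided V d
          ≡⟨ sym (∑-* (n * 2 + 1) M _) ⟩
        ∑ M (λ j → (n * 2 + 1) * (suc j * V (n ∸ d * suc j)))
          ≡⟨ ∑-cong M (λ j _ → trans (ring₁ (n * 2 + 1) (suc j) _) (trans (cong (suc j *_) (V-split (d * suc j))) (ring₂ (suc j) D _ (d * suc j) _))) ⟩
        ∑ M (λ j → D * (suc j * e (n ∸ d * suc j)) + 2 * (suc j * (d * suc j) * V (n ∸ d * suc j)))
          ≡⟨ trans (∑-+ M _ _) (cong₂ _+_ (∑-* D M _) (∑-* 2 M _)) ⟩
        D * strided e d + 2 * strided² d ∎
        where
        ring₁ : ∀ a b c → a * (b * c) ≡ b * (a * c)
        ring₁ = solve-∀
        ring₂ : ∀ j D x k v → j * (D * x + 2 * (k * v)) ≡ D * (j * x) + 2 * (j * k * v)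
        ring₂ = solve-∀

      Λ-split : (n * 2 + 1) * Λ ≡ D * R + 2 * Ψ
      Λ-split = trans (sym (∑-* (n * 2 + 1) k _)) (trans (∑-cong k (λ i _ → strided-split (2 + i)))
        (trans (∑-+ k _ _) (cong₂ _+_ (∑-* D k _) (∑-* 2 k _))))

      3R≤2f : 3 * R ≤ 2 * f
      3R≤2f = basel k f (λ i → strided e (2 + i)) (λ i _ → strided-e-bound M (suc i) n n≤1+k)

      R+f≤n*p : R + f ≤ n * p n
      R+f≤n*p = begin
        R + f                                   ≡⟨ +-comm R f ⟩
        f + R                                   ≡⟨ cong (_+ R) (sym (unit-stride M n e refl n≤1+k)) ⟩
        strided e 1 + R                         ≡⟨ sym (∑-head k (λ i → strided e (suc i))) ⟩
        ∑ M (λ i → strided e (suc i))           ≤⟨ m≤m+n _ (strided e (suc M)) ⟩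
        ∑ (suc M) (λ i → strided e (suc i))     ≤⟨ ∑-mono (suc M) (λ i _ → ≤-trans (m≤m+n (strided e (suc i)) _) (∑-mono (suc M) (λ j _ → *-monoʳ-≤ (suc j) (e≤shift (suc i * suc j))))) ⟩
        ∑ (suc M) (λ i → ∑ (suc M) (λ j → suc j * shift p (suc n ∸ suc i * suc j)))
                                                ≡⟨ sym (divisor-sum-identity (suc M) n (s≤s n≤1+k)) ⟩
        n * p n                                 ∎
        where
        e≤shift : ∀ c → e (n ∸ c) ≤ shift p (suc n ∸ c)
        e≤shift c with c ≤? n
        ... | yes c≤n rewrite +-∸-assoc 1 c≤n = e≤p (n ∸ c)
        ... | no  c≰n rewrite m≤n⇒m∸n≡0 (<⇒≤ (≰⇒> c≰n)) = z≤n

      -- Stride d carries at most 3/(2d²) of `squares`, up to S/2; `basel-shifted` sums the main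
      -- parts to `squares` and leaves one S/2 for each of the k strides.
      2Ψ≤ : 2 * Ψ ≤ 2 * squares + k * S
      2Ψ≤ = *-cancelˡ-≤ 3 (begin
        3 * (2 * Ψ)                                   ≡⟨ cong (3 *_) (sym (∑-* 2 k _)) ⟩
        3 * ∑ k (λ i → 2 * strided² (2 + i))          ≤⟨ basel-shifted k (3 * squares) S _ (λ i _ → block i) ⟩
        2 * (3 * squares) + 3 * (k * S)               ≡⟨ ring₁ squares (k * S) ⟩
        3 * (2 * squares + k * S)                     ∎)
        where
        ring₁ : ∀ q s → 2 * (3 * q) + 3 * s ≡ 3 * (2 * q + s)
        ring₁ = solve-∀
        ring₂ : ∀ d y → d * d * (2 * y) ≡ 2 * (d * d) * y
        ring₂ = solve-∀
        ring₃ : ∀ q d v → (3 * q + d) * v ≡ 3 * (q * v) + d * v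
        ring₃ = solve-∀
        v-dec : ∀ j → V (n ∸ suc j) ≤ V (n ∸ j)
        v-dec j with j <? n
        ... | yes j<n = subst (λ z → V (n ∸ suc j) ≤ V z) (sym (+-∸-assoc 1 j<n)) (V-mono (n ∸ suc j)
                          (∸-monoʳ-< {n} {suc j} {0} (s≤s z≤n) j<n))
        ... | no  j≮n = ≤-reflexive (cong V (trans (m≤n⇒m∸n≡0 (m≤n⇒m≤1+n (≮⇒≥ j≮n))) (sym (m≤n⇒m∸n≡0 (≮⇒≥ j≮n)))))
        v-end : ∀ j → n ≤ j → V (n ∸ suc j) ≡ 0
        v-end j n≤j = trans (cong V (m≤n⇒m∸n≡0 (m≤n⇒m≤1+n n≤j))) V-zero
        block : ∀ i → (2 + i) ² * (2 * strided² (2 + i)) ≤ 3 * squares + (2 + i) ² * S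
        block i = begin
          d ² * (2 * strided² d)
            ≡⟨ ring₂ d (strided² d) ⟩
          2 * d ² * strided² d
            ≤⟨ strided-square-bound d M (λ j → V (n ∸ j)) v-dec ⟩
          ∑ (d * M) (λ j → (3 * suc j ² + d ²) * V (n ∸ suc j))
            ≡⟨ ∑-extend (≤-trans n≤1+k (m≤n*m M d)) (λ j n≤j → trans (cong ((3 * suc j ² + d ²) *_) (v-end j n≤j)) (*-zeroʳ (3 * suc j ² + d ²))) ⟩
          ∑ n (λ j → (3 * suc j ² + d ²) * V (n ∸ suc j))
            ≡⟨ ∑-cong n (λ j _ → ring₃ (suc j ²) (d ²) (V (n ∸ suc j))) ⟩
          ∑ n (λ j → 3 * (suc j ² * V (n ∸ suc j)) + d ² * V (n ∸ suc j))
            ≡⟨ trans (∑-+ n _ _) (cong₂ _+_ (∑-* 3 n _) (trans (∑-* (d ²) n _) (cong (d ² *_) (∑-reverse n V)))) ⟩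
          3 * squares + d ² * S ∎
          where
          d : ℕ
          d = 2 + i

      B : ℕ
      B = n + K + L

      L∑∑∑V≤B∑∑V : L * ∑∑∑ V n ≤ B * W
      L∑∑∑V≤B∑∑V = begin
        L * ∑∑∑ V n                       ≡⟨ sym (∑-* L (suc n) (∑∑ V)) ⟩
        ∑ (suc n) (λ t → L * ∑∑ V t)      ≤⟨ ∑-mono (suc n) (λ t t≤n → ≤-trans (∑∑V-bound t (λ s s<t → ratio s (≤-trans (<⇒≤ s<t) (≤-pred t≤n))))
                                               (*-monoˡ-≤ (∑ t V) (+-monoˡ-≤ L (+-monoˡ-≤ K (≤-pred t≤n))))) ⟩
        ∑ (suc n) (λ t → B * ∑ t V)       ≡⟨ ∑-* B (suc n) (λ t → ∑ t V) ⟩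
        B * W                             ∎

      -- `squares` is 2 ∑∑∑V - ∑∑V, and the ratios bound ∑∑∑V by about n/L times ∑∑V, which
      -- `∑∑V-identity` bounds through f. The leading coefficients in n require 48 ≤ 2L - 4, so L =
      -- 30 leaves room.
      squares-bound : ∀ C → 0 < L → L * (n * 2 + 3) ≡ 4 * B + C → 48 * B ≤ C + 24 * L → 24 * squares ≤ D * f
      squares-bound C L>0 splitting numeric = *-cancelˡ-≤ L {{>-nonZero L>0}} (≤-trans lower upper)
        where
        ring₁ : ∀ L q w → L * (24 * q) + 24 * L * w ≡ 24 * (L * (q + w))
        ring₁ = solve-∀
        ring₂ : ∀ L q → 24 * (L * (2 * q)) ≡ 48 * (L * q)
        ring₂ = solve-∀
        ring₃ : ∀ L x q → L * (x + 4 * q) ≡ L * x + 4 * (L * q)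
        ring₃ = solve-∀
        lower : L * (24 * squares) ≤ C * W
        lower = +-cancelʳ-≤ (24 * L * W) _ _ (begin
          L * (24 * squares) + 24 * L * W   ≡⟨ ring₁ L squares W ⟩
          24 * (L * (squares + W))          ≡⟨ cong (λ z → 24 * (L * z)) (∑∑∑-weighted n V) ⟩
          24 * (L * (2 * ∑∑∑ V n))          ≡⟨ ring₂ L (∑∑∑ V n) ⟩
          48 * (L * ∑∑∑ V n)                ≤⟨ *-monoʳ-≤ 48 L∑∑∑V≤B∑∑V ⟩
          48 * (B * W)                      ≡⟨ sym (*-assoc 48 B W) ⟩
          48 * B * W                        ≤⟨ *-monoˡ-≤ W numeric ⟩
          (C + 24 * L) * W                  ≡⟨ *-distribʳ-+ W C (24 * L) ⟩
          C * W + 24 * L * W                ∎)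
        upper : C * W ≤ L * (D * f)
        upper = +-cancelʳ-≤ (4 * (B * W)) _ _ (begin
          C * W + 4 * (B * W)               ≡⟨ trans (+-comm (C * W) _) (cong (_+ C * W) (sym (*-assoc 4 B W))) ⟩
          4 * B * W + C * W                 ≡⟨ sym (*-distribʳ-+ W (4 * B) C) ⟩
          (4 * B + C) * W                   ≡⟨ cong (_* W) (sym splitting) ⟩
          L * (n * 2 + 3) * W               ≡⟨ *-assoc L (n * 2 + 3) W ⟩
          L * ((n * 2 + 3) * W)             ≡⟨ cong (L *_) (∑∑V-identity n ≤-refl) ⟩
          L * (D * f + 4 * ∑∑∑ V n)         ≡⟨ ring₃ L (D * f) (∑∑∑ V n) ⟩
          L * (D * f) + 4 * (L * ∑∑∑ V n)   ≤⟨ +-monoʳ-≤ (L * (D * f)) (*-monoʳ-≤ 4 L∑∑∑V≤B∑∑V) ⟩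
          L * (D * f) + 4 * (B * W)         ∎)

      -- A linear program: 12R + f is largest when R + f ≤ n p(n) and 3R ≤ 2f are both tight, at R =
      -- (2/5) n p(n). The multipliers 27 and 11 are the dual solution.
      5[12R+f]≤27n*p : 5 * (12 * R + f) ≤ 27 * (n * p n)
      5[12R+f]≤27n*p = +-cancelʳ-≤ (11 * (2 * f)) _ _ (begin
        5 * (12 * R + f) + 11 * (2 * f)     ≡⟨ ring R f ⟩
        27 * (R + f) + 11 * (3 * R)         ≤⟨ +-mono-≤ (*-monoʳ-≤ 27 R+f≤n*p) (*-monoʳ-≤ 11 3R≤2f) ⟩
        27 * (n * p n) + 11 * (2 * f)       ∎)
        where
        ring : ∀ R f → 5 * (12 * R + f) + 11 * (2 * f) ≡ 27 * (R + f) + 11 * (3 * R)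
        ring = solve-∀

      -- In the limit this is Λ ≤ (27/120 + 1/(4L)) D p(n), which is 7/30 of D p(n) for L = 30: the
      -- first fraction from R + f/12, the second from the kS in `2Ψ≤`.
      Λ-bound : 1 ≤ n → 24 * squares ≤ D * f →
        L * 60 * ((n * 2 + 1) * ((n * 2 + 1) * Λ)) ≤ (27 * L * (n * (n * 2 + 1)) + 60 * (k * (n + K))) * (D * p n)
      Λ-bound 1≤n squares≤ = begin
        L * 60 * (A * (A * Λ))                                                      ≡⟨ cong (λ z → L * 60 * (A * z)) Λ-split ⟩
        L * 60 * (A * (D * R + 2 * Ψ))                                              ≤⟨ *-monoʳ-≤ (L * 60) (*-monoʳ-≤ A (+-monoʳ-≤ (D * R) 2Ψ≤)) ⟩
        L * 60 * (A * (D * R + (2 * squares + k * S)))                              ≡⟨ ring₁ L A (D * R) squares (k * S) ⟩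
        L * 5 * (A * (12 * (D * R) + 24 * squares)) + 60 * (A * (L * (k * S)))      ≤⟨ +-mono-≤ (*-monoʳ-≤ (L * 5) (*-monoʳ-≤ A (+-monoʳ-≤ (12 * (D * R)) squares≤)))
                                                                                          (*-monoʳ-≤ 60 (*-monoʳ-≤ A (≤-trans (≤-reflexive (ring₂ L k S)) (*-monoʳ-≤ k (ratio n ≤-refl))))) ⟩
        L * 5 * (A * (12 * (D * R) + D * f)) + 60 * (A * (k * ((n + K) * V n)))     ≡⟨ cong₂ _+_ (ring₃ L A D R f) (ring₄ A k (n + K) (V n)) ⟩
        L * (A * (D * (5 * (12 * R + f)))) + 60 * (k * ((n + K) * (A * V n)))       ≤⟨ +-mono-≤ (*-monoʳ-≤ L (*-monoʳ-≤ A (*-monoʳ-≤ D 5[12R+f]≤27n*p)))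
                                                                                          (≤-reflexive (cong (λ z → 60 * (k * ((n + K) * z))) (trans (V-spec n ≤-refl) (cong (D *_) (e≡p 1≤n))))) ⟩
        L * (A * (D * (27 * (n * p n)))) + 60 * (k * ((n + K) * (D * p n)))         ≡⟨ ring₅ L A D n (p n) (k) (n + K) ⟩
        (27 * L * (n * A) + 60 * (k * (n + K))) * (D * p n) ∎
        where
        A : ℕ
        A = n * 2 + 1
        e≡p : ∀ {m} → 1 ≤ m → e m ≡ p m
        e≡p (s≤s _) = refl
        ring₁ : ∀ L A r q s → L * 60 * (A * (r + (2 * q + s))) ≡ L * 5 * (A * (12 * r + 24 * q)) + 60 * (A * (L * s))
        ring₁ = solve-∀
        ring₂ : ∀ L k s → L * (k * s) ≡ k * (L * s)
        ring₂ = solve-∀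
        ring₃ : ∀ L A D R f → L * 5 * (A * (12 * (D * R) + D * f)) ≡ L * (A * (D * (5 * (12 * R + f))))
        ring₃ = solve-∀
        ring₄ : ∀ A k c v → 60 * (A * (k * (c * v))) ≡ 60 * (k * (c * (A * v)))
        ring₄ = solve-∀
        ring₅ : ∀ L A D n N k c → L * (A * (D * (27 * (n * N)))) + 60 * (k * (c * (D * N))) ≡ (27 * L * (n * A) + 60 * (k * c)) * (D * N)
        ring₅ = solve-∀

-- The values up to 1400

-- lagged front back xs adds to each entry of xs the entry k places earlier in the output, the last k
-- outputs being kept in the queue front ++ reverse back.
lagged : List ℕ → List ℕ → List ℕ → List ℕ
emit   : ℕ → List ℕ → List ℕ → List ℕ → List ℕ
refill : List ℕ → ℕ → List ℕ → List ℕ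
lagged front       back []       = []
lagged (q ∷ front) back (x ∷ xs) = emit (q + x) front back xs
lagged []          back (x ∷ xs) = refill (back ʳ++ []) x xs
emit y front back xs             = y ∷ lagged front (y ∷ back) xs
refill []          x xs          = []
refill (q ∷ front) x xs          = emit (q + x) front [] xs

add-part : ℕ → List ℕ → List ℕ
add-part k row = take k row ++ lagged (take k row) [] (drop k row)

row : ℕ → ℕ → List ℕ
row zero    len = 1 ∷ replicate len 0
row (suc m) len = add-part (suc m) (row m len)

segment segmentʳ : (ℕ → ℕ) → ℕ → ℕ → List ℕ
segment f a zero     = []
segment f a (suc l)  = f a ∷ segment f (suc a) l
segmentʳ f a zero    = []
segmentʳ f a (suc l) = f (a + l) ∷ segmentʳ f a l

segment-cong : ∀ {f g : ℕ → ℕ} a l → (∀ i → i < a + l → f i ≡ g i) → segment f a l ≡ segment g a l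
segment-cong a zero    eq = refl
segment-cong a (suc l) eq = cong₂ _∷_ (eq a (m<m+n a (s≤s z≤n))) (segment-cong (suc a) l (λ i i< → eq i (subst (i <_) (sym (+-suc a l)) i<)))

segment-++ : ∀ f a l r → segment f a l ++ segment f (a + l) r ≡ segment f a (l + r)
segment-++ f a zero    r = cong (λ z → segment f z r) (+-identityʳ a)
segment-++ f a (suc l) r = cong (f a ∷_) (trans (cong (λ z → segment f (suc a) l ++ segment f z r) (+-suc a l)) (segment-++ f (suc a) l r))

take-segment : ∀ f a l r → take l (segment f a (l + r)) ≡ segment f a l
take-segment f a zero    r = refl
take-segment f a (suc l) r = cong (f a ∷_) (take-segment f (suc a) l r)

drop-segment : ∀ f a l r → drop l (segment f a (l + r)) ≡ segment f (a + l) r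
drop-segment f a zero    r = cong (λ z → segment f z r) (sym (+-identityʳ a))
drop-segment f a (suc l) r = trans (drop-segment f (suc a) l r) (cong (λ z → segment f z r) (sym (+-suc a l)))

segmentʳ-ʳ++ : ∀ f a l r → segmentʳ f a l ʳ++ segment f (a + l) r ≡ segment f a (l + r)
segmentʳ-ʳ++ f a zero    r = cong (λ z → segment f z r) (+-identityʳ a)
segmentʳ-ʳ++ f a (suc l) r = trans (cong (λ z → segmentʳ f a l ʳ++ (f (a + l) ∷ segment f z r)) (+-suc a l))
  (trans (segmentʳ-ʳ++ f a l (suc r)) (cong (segment f a) (+-suc l r)))

module _ (g o : ℕ → ℕ) (k : ℕ) (recurrence : ∀ n → g n + o (n + suc k) ≡ g (n + suc k)) where

  -- Queue invariant: it holds the k + 1 values of g from n on, the first l₁ in order in front, the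
  -- other l₂ reversed in the back.
  lagged-segment : ∀ r n l₁ l₂ → l₁ + l₂ ≡ suc k →
    lagged (segment g n l₁) (segmentʳ g (n + l₁) l₂) (segment o (n + suc k) r) ≡ segment g (n + suc k) r
  emit-segment : ∀ r n l₁ l₂ → l₁ + l₂ ≡ k →
    emit (g n + o (n + suc k)) (segment g (suc n) l₁) (segmentʳ g (n + suc l₁) l₂) (segment o (suc (n + suc k)) r)
      ≡ segment g (n + suc k) (suc r)
  lagged-segment zero    n l₁        l₂ eq = refl
  lagged-segment (suc r) n (suc l₁)  l₂ eq = emit-segment r n l₁ l₂ (suc-injective eq)
  lagged-segment (suc r) n zero      l₂ refl = trans
    (cong (λ z → refill z (o (n + suc k)) (segment o (suc (n + suc k)) r))
      (trans (cong (λ z → segmentʳ g z (suc k) ʳ++ []) (+-identityʳ n)) (trans (segmentʳ-ʳ++ g n (suc k) 0) (cong (segment g n) (+-identityʳ (suc k))))))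
    (emit-segment r n k 0 (+-identityʳ k))
  emit-segment r n l₁ l₂ eq = cong₂ _∷_ (recurrence n) (trans
    (cong (λ u → lagged (segment g (suc n) l₁) u (segment o (suc (n + suc k)) r)) back-eq)
    (lagged-segment r (suc n) l₁ (suc l₂) (trans (+-suc l₁ l₂) (cong suc eq))))
    where
    back-eq : (g n + o (n + suc k)) ∷ segmentʳ g (n + suc l₁) l₂ ≡ segmentʳ g (suc n + l₁) (suc l₂)
    back-eq = cong₂ _∷_
      (trans (recurrence n) (cong g (trans (+-suc n k) (cong suc (trans (cong (n +_) (sym eq)) (sym (+-assoc n l₁ l₂)))))))
      (cong (λ z → segmentʳ g z l₂) (+-suc n l₁))

  add-part-segment : ∀ r → (∀ i → i < suc k → o i ≡ g i) → add-part (suc k) (segment o 0 (suc k + r)) ≡ segment g 0 (suc k + r)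
  add-part-segment r start = begin
    take (suc k) s ++ lagged (take (suc k) s) [] (drop (suc k) s)
      ≡⟨ cong₂ (λ u v → u ++ lagged u [] v) (trans (take-segment o 0 (suc k) r) (segment-cong 0 (suc k) start)) (drop-segment o 0 (suc k) r) ⟩
    segment g 0 (suc k) ++ lagged (segment g 0 (suc k)) [] (segment o (suc k) r)
      ≡⟨ cong (segment g 0 (suc k) ++_) (lagged-segment r 0 (suc k) 0 (+-identityʳ (suc k))) ⟩
    segment g 0 (suc k) ++ segment g (suc k) r
      ≡⟨ segment-++ g 0 (suc k) r ⟩
    segment g 0 (suc k + r) ∎
    where
    open ≡-Reasoning
    s : List ℕ
    s = segment o 0 (suc k + r)

row-correct : ∀ m len → m ≤ len → row m len ≡ segment (count m) 0 (suc len)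
row-correct zero    len _   = cong (1 ∷_) (zeros len 0)
  where
  zeros : ∀ l a → replicate l 0 ≡ segment (count 0) (suc a) l
  zeros zero    a = refl
  zeros (suc l) a = cong₂ _∷_ (sym (count-by-largest-part 0 a)) (zeros l (suc a))
row-correct (suc m) len m<len = begin
  add-part (suc m) (row m len)
    ≡⟨ cong (add-part (suc m)) (row-correct m len (<⇒≤ m<len)) ⟩
  add-part (suc m) (segment (count m) 0 (suc len))
    ≡⟨ cong (λ z → add-part (suc m) (segment (count m) 0 z)) (sym len-eq) ⟩
  add-part (suc m) (segment (count m) 0 (suc m + (len ∸ m)))
    ≡⟨ add-part-segment (count (suc m)) (count m) m rec (len ∸ m) start ⟩
  segment (count (suc m)) 0 (suc m + (len ∸ m))
    ≡⟨ cong (segment (count (suc m)) 0) len-eq ⟩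
  segment (count (suc m)) 0 (suc len) ∎
  where
  open ≡-Reasoning
  len-eq : suc m + (len ∸ m) ≡ suc len
  len-eq = cong suc (m+[n∸m]≡n (<⇒≤ m<len))
  rec : ∀ n → count (suc m) n + count m (n + suc m) ≡ count (suc m) (n + suc m)
  rec n = trans (+-comm (count (suc m) n) _) (sym (trans (count-rec m (suc (n + suc m)))
    (cong (λ z → count m (n + suc m) + shift (count (suc m)) z) (m+n∸n≡m′))))
    where
    m+n∸n≡m′ : n + suc m ∸ m ≡ suc n
    m+n∸n≡m′ = trans (cong (_∸ m) (+-suc n m)) (m+n∸n≡m (suc n) m)
  start : ∀ i → i < suc m → count m i ≡ count (suc m) i
  start i i≤m = sym (trans (count-rec m (suc i)) (trans (cong (count m i +_) (shift-∸≡0 (count (suc m)) (≤-pred i≤m))) (+-identityʳ (count m i))))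

table : ℕ → List ℕ
table len = row len len

table-correct : ∀ len → table len ≡ segment p 0 (suc len)
table-correct len = trans (row-correct len len ≤-refl) (segment-cong 0 (suc len) (λ i i≤len → count-stable len i (≤-pred i≤len)))

module Check (local : ℕ → ℕ → ℕ → ℕ → Bool) where

  check : ℕ → List ℕ → Bool
  check n (x ∷ y ∷ z ∷ zs) = local n x y z ∧ check (suc n) (y ∷ z ∷ zs)
  check n _                = true

  check-sound : ∀ f l n → T (check n (segment f n (2 + l))) → ∀ i → i < l → T (local (n + i) (f (n + i)) (f (suc (n + i))) (f (2 + (n + i))))
  check-sound f (suc l) n ok zero    _         = subst (λ z → T (local z (f z) (f (suc z)) (f (2 + z)))) (sym (+-identityʳ n))
    (proj₁ (Equivalence.to T-∧ ok))
  check-sound f (suc l) n ok (suc i) (s≤s i<l) = subst (λ z → T (local z (f z) (f (suc z)) (f (2 + z)))) (sym (+-suc n i))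
    (check-sound f l (suc n) (proj₂ (Equivalence.to (T-∧ {local n (f n) (f (suc n)) (f (2 + n))}) ok)) i i<l)

  table-check : ∀ l → check 0 (table (suc l)) ≡ true → ∀ i → i < l → T (local i (p i) (p (suc i)) (p (2 + i)))
  table-check l ok = check-sound p l 0 (subst (λ z → T (check 0 z)) (table-correct (suc l)) (Equivalence.from T-≡ ok))

-- All tests are bundled so that one table serves them. `ratio-check` is the hypothesis of
-- `ratio-suc` for K = 200 and L = 30; `size-check` starts `prefix-growth`, with 14800 = 6 · 1400 +
-- 80².
log-convex-check ratio-check size-check local-check : ℕ → ℕ → ℕ → ℕ → Bool
log-convex-check n x y z = suc n * (y * y) <ᵇ x * ((2 + n) * z)
ratio-check n x y z      = (n <ᵇ 6) ∨ ((n + 200 + 30) * ((suc n * 2 + 1) * x) ≤ᵇ (suc n + 200) * ((n * 2 + 1) * y))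
size-check n x y z       = (n <ᵇ 1000) ∨ (fourth 14800 ≤ᵇ x)
local-check n x y z      = log-convex-check n x y z ∧ ratio-check n x y z ∧ size-check n x y z


-- By evaluation of p(0), ..., p(1401): the last window starts at 1399 and reaches two further.
finite-check : Check.check local-check 0 (table (suc 1400)) ≡ true
finite-check = refl

∨-resolve : ∀ {n m} b → m ≤ n → T ((n <ᵇ m) ∨ b) → T b
∨-resolve {n} {m} b m≤n t with Equivalence.to (T-∨ {n <ᵇ m}) t
... | inj₁ n<m = contradiction (<ᵇ⇒< n m n<m) (≤⇒≯ m≤n)
... | inj₂ tb  = tb

module _ (i : ℕ) (i<1400 : i < 1400) where

  private
    all-checks = Check.table-check local-check 1400 finite-check i i<1400
    split      = Equivalence.to (T-∧ {log-convex-check i (p i) (p (suc i)) (p (2 + i))}) all-checks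
    split′     = Equivalence.to (T-∧ {ratio-check i (p i) (p (suc i)) (p (2 + i))}) (proj₂ split)

  log-convex-small : suc i * (p (suc i) * p (suc i)) < p i * ((2 + i) * p (2 + i))
  log-convex-small = <ᵇ⇒< _ _ (proj₁ split)

  ratio-small-values : 6 ≤ i → (i + 200 + 30) * ((suc i * 2 + 1) * p i) ≤ (suc i + 200) * ((i * 2 + 1) * p (suc i))
  ratio-small-values 6≤i = ≤ᵇ⇒≤ _ _ (∨-resolve {i} {6} ((i + 200 + 30) * ((suc i * 2 + 1) * p i) ≤ᵇ (suc i + 200) * ((i * 2 + 1) * p (suc i))) 6≤i (proj₁ split′))

  large-value : 1000 ≤ i → fourth 14800 ≤ p i
  large-value 1000≤i = ≤ᵇ⇒≤ _ _ (∨-resolve {i} {1000} (fourth 14800 ≤ᵇ p i) 1000≤i (proj₂ split′))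

-- The quadratic form

LogConvexAt : ℕ → Set
LogConvexAt m = suc m * (p (suc m) * p (suc m)) < p m * ((2 + m) * p (2 + m))

-- Removing one of two equal largest parts k + 2 leaves a smaller remainder than removing a single
-- one does, and `count` is monotone. So p at most doubles in one step.
increment≤p : ∀ n → increment (suc n) ≤ p (suc n)
increment≤p n = begin
  1 + (∑ n t + t n)                                                           ≡⟨ cong (λ z → 1 + (∑ n t + z)) (shift-∸≡0 (count (2 + n)) (m≤n*m (suc n) 2)) ⟩
  1 + (∑ n t + 0)                                                             ≡⟨ cong suc (+-identityʳ (∑ n t)) ⟩
  1 + ∑ n t                                                                   ≤⟨ s≤s (∑-mono n (λ k _ → count-mono-≤ (suc k) (∸-monoʳ-≤ {suc k} {2 * suc k} (suc n) (m≤n*m (suc k) 2)))) ⟩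
  1 + ∑ n (λ k → shift (count (2 + k)) (suc n ∸ suc k))                       ≡⟨ cong (_+ ∑ n (λ k → shift (count (2 + k)) (n ∸ k))) (sym (count-one n)) ⟩
  count 1 n + ∑ n (λ k → shift (count (2 + k)) (suc n ∸ suc k))               ≡⟨ sym (∑-head n (λ i → shift (count (suc i)) (suc n ∸ i))) ⟩
  ∑ (suc n) (λ i → shift (count (suc i)) (suc n ∸ i))                         ≡⟨ sym (count-by-largest-part (suc n) n) ⟩
  p (suc n)                                                                   ∎
  where
  open ≤-Reasoning
  t : ℕ → ℕ
  t k = shift (count (2 + k)) (suc n ∸ 2 * suc k)

square-reflects-≤ : ∀ x y → x ² ≤ y ² → x ≤ y
square-reflects-≤ x y x²≤y² with x ≤? y
... | yes x≤y = x≤y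
... | no  x≰y = contradiction x²≤y² (<⇒≱ (*-mono-< (≰⇒> x≰y) (≰⇒> x≰y)))

-- p₊a² + p₋N² ≥ 2aN √(p₋p₊) ≥ 2aN p₀ √(m/(m+1)), and √(m/(m+1)) ≥ 2m/(2m+1).
discriminant : ∀ m p₋ p₀ p₊ a N → m * (p₀ * p₀) ≤ p₋ * (suc m * p₊) →
  4 * m * (a * N * p₀) ≤ (m * 2 + 1) * (p₊ * (a * a) + p₋ * (N * N))
discriminant m p₋ p₀ p₊ a N h = square-reflects-≤ _ _ (begin
  (4 * m * (a * N * p₀)) ²                          ≡⟨ ring₁ m a N p₀ ⟩
  16 * (m * (a * N * (a * N))) * (m * (p₀ * p₀))    ≤⟨ *-monoʳ-≤ (16 * (m * (a * N * (a * N)))) h ⟩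
  16 * (m * (a * N * (a * N))) * (p₋ * (suc m * p₊)) ≡⟨ ring₂ m a N p₋ p₊ ⟩
  4 * (m * suc m) * (4 * (u * v))                   ≤⟨ *-mono-≤ (≤-trans (m≤m+n _ 1) (≤-reflexive (ring₃ m))) 4uv≤ ⟩
  ((m * 2 + 1) * (m * 2 + 1)) * ((u + v) * (u + v)) ≡⟨ [m*n]*[o*p]≡[m*o]*[n*p] (m * 2 + 1) (m * 2 + 1) (u + v) (u + v) ⟩
  ((m * 2 + 1) * (u + v)) ²                         ∎)
  where
  open ≤-Reasoning
  u v : ℕ
  u = p₊ * (a * a)
  v = p₋ * (N * N)
  ring₁ : ∀ m a N p → (4 * m * (a * N * p)) * (4 * m * (a * N * p)) ≡ 16 * (m * (a * N * (a * N))) * (m * (p * p))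
  ring₁ = solve-∀
  ring₂ : ∀ m a N q r → 16 * (m * (a * N * (a * N))) * (q * (suc m * r)) ≡ 4 * (m * suc m) * (4 * (r * (a * a) * (q * (N * N))))
  ring₂ = solve-∀
  ring₃ : ∀ m → 4 * (m * suc m) + 1 ≡ (m * 2 + 1) * (m * 2 + 1)
  ring₃ = solve-∀
  ring₄ : ∀ u v → 4 * (u * v) ≡ 2 * (u * v) + 2 * (u * v)
  ring₄ = solve-∀
  ring₅ : ∀ u v → u * u + v * v + 2 * (u * v) ≡ (u + v) * (u + v)
  ring₅ = solve-∀
  4uv≤ : 4 * (u * v) ≤ (u + v) * (u + v)
  4uv≤ = ≤-trans (≤-reflexive (ring₄ u v)) (≤-trans (+-monoˡ-≤ (2 * (u * v)) (2xy≤x²+y² u v)) (≤-reflexive (ring₅ u v)))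

-- Completing the square in Y = 2S₀ + N.
moment-form : ∀ a b S₀ S₁ → 0 < a + b → (2 * S₀ + (a + b)) ² ≤ (a + b) * (6 * S₁ + (a + b)) →
  12 * ((a + b) * (a + b) * a) + 24 * (b * (a + b + a) * S₀)
    ≤ 24 * ((a + b) * a * (a + b + a)) + 24 * (b * b * S₁) + (a + b) * (b * b)
-- After S₁ is bounded by `moments`, the difference of the sides is governed by 4b²Y²/N - 12bMY,
-- minimal at 2bY = 3MN, where AM-GM is applied. The constant that remains is 3NM² - 4Nb² = 12aN² -
-- Nb², because M² = (N + a)² = 4aN + b².
moment-form a b S₀ S₁ N>0 moments = *-cancelˡ-≤ N {{>-nonZero N>0}} (+-cancelʳ-≤ (Y * Y * (4 * (b * b)) + extra a b) _ _ (begin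
  N * (12 * (N * N * a) + 24 * (b * M * S₀)) + (Y * Y * (4 * (b * b)) + extra a b)
    ≡⟨ ring₁ a b S₀ ⟩
  lower a b + (2 * (2 * (b * Y) * (3 * (M * N))) + Y * Y * (4 * (b * b)))
    ≤⟨ +-monoʳ-≤ (lower a b) (+-mono-≤ (2xy≤x²+y² (2 * (b * Y)) (3 * (M * N))) (*-monoˡ-≤ (4 * (b * b)) moments)) ⟩
  lower a b + ((2 * (b * Y)) ² + (3 * (M * N)) ² + N * (6 * S₁ + N) * (4 * (b * b)))
    ≡⟨ ring₂ a b S₀ S₁ ⟩
  N * (24 * (N * a * M) + 24 * (b * b * S₁) + N * (b * b)) + (Y * Y * (4 * (b * b)) + extra a b) ∎))
  where
  open ≤-Reasoning
  N M Y : ℕ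
  N = a + b
  M = a + b + a
  Y = 2 * S₀ + (a + b)
  extra lower : ℕ → ℕ → ℕ
  extra a b = 12 * (b * (a + b + a) * ((a + b) * (a + b)))
  lower a b = 12 * ((a + b) * ((a + b) * (a + b) * a))
  ring₁ : ∀ a b S₀ → (a + b) * (12 * ((a + b) * (a + b) * a) + 24 * (b * (a + b + a) * S₀)) + ((2 * S₀ + (a + b)) * (2 * S₀ + (a + b)) * (4 * (b * b)) + 12 * (b * (a + b + a) * ((a + b) * (a + b))))
     ≡ 12 * ((a + b) * ((a + b) * (a + b) * a)) + (2 * (2 * (b * (2 * S₀ + (a + b))) * (3 * ((a + b + a) * (a + b)))) + (2 * S₀ + (a + b)) * (2 * S₀ + (a + b)) * (4 * (b * b)))
  ring₁ = solve-∀
  ring₂ : ∀ a b S₀ S₁ → 12 * ((a + b) * ((a + b) * (a + b) * a)) + ((2 * (b * (2 * S₀ + (a + b)))) * (2 * (b * (2 * S₀ + (a + b)))) + (3 * ((a + b + a) * (a + b))) * (3 * ((a + b + a) * (a + b))) + (a + b) * (6 * S₁ + (a + b)) * (4 * (b * b)))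
     ≡ (a + b) * (24 * ((a + b) * a * (a + b + a)) + 24 * (b * b * S₁) + (a + b) * (b * b)) + ((2 * S₀ + (a + b)) * (2 * S₀ + (a + b)) * (4 * (b * b)) + 12 * (b * (a + b + a) * ((a + b) * (a + b))))
  ring₂ = solve-∀

-- Here a = p(n-1), a + b = p(n), n = k + 1, G = (n+1) p(n+1), and r₂, r₁, r₀ are the contributions of the
-- strides i ≥ 2 to the divisor sum identity at n + 1, n, n - 1.
assemble : ∀ k a b S₀ S₁ r₀ r₁ r₂ D ℓ G → 0 < a → b ≤ a →
  suc k * (a + b) ≡ S₁ + r₁ → k * a + S₀ ≡ S₁ + r₀ → G ≡ a + b + S₀ + S₁ + r₂ →
  2 * (a * (a + b)) * (D * r₁) ≤ D * (r₂ * (a * a) + r₀ * ((a + b) * (a + b))) + 2 * (a * (a + b)) * ℓ →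
  (2 * S₀ + (a + b)) ² ≤ (a + b) * (6 * S₁ + (a + b)) → 96 * ℓ < 23 * ((a + b) * D) →
  suc k * ((a + b) * (a + b)) < a * G
assemble k a b S₀ S₁ r₀ r₁ r₂ D ℓ G a>0 b≤a eq₁ eq₀ eq₂ strides moments small = ≰⇒> impossible
  where
  open ≤-Reasoning
  N M : ℕ
  N = a + b
  M = a + b + a
  N>0 : 0 < N
  N>0 = ≤-trans a>0 (m≤m+n a b)
  module _ (contra : a * G ≤ suc k * (N * N)) where
    -- Q combines the identities with coefficients a², -2aN, N². One copy of aN times the identity
    -- at n enters here, against the negated claim at n + 1; the other enters `E`, against the
    -- identity at n - 1.
    H : a * a * (N + S₀ + S₁ + r₂) ≤ a * N * (S₁ + r₁)
    H = begin
      a * a * (N + S₀ + S₁ + r₂)   ≡⟨ trans (cong (a * a *_) (sym eq₂)) (*-assoc a a G) ⟩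
      a * (a * G)                  ≤⟨ *-monoʳ-≤ a contra ⟩
      a * (suc k * (N * N))        ≡⟨ ring a (suc k) N ⟩
      a * N * (suc k * N)          ≡⟨ cong (a * N *_) eq₁ ⟩
      a * N * (S₁ + r₁)            ∎
      where
      ring : ∀ a k N → a * (k * (N * N)) ≡ a * N * (k * N)
      ring = solve-∀
    E : N * N * (S₁ + r₀) + a * (N * N) ≡ a * N * (S₁ + r₁) + N * N * S₀
    E = begin-equality
      N * N * (S₁ + r₀) + a * (N * N)    ≡⟨ cong (λ z → N * N * z + a * (N * N)) (sym eq₀) ⟩
      N * N * (k * a + S₀) + a * (N * N) ≡⟨ ring a k N S₀ ⟩
      a * N * (suc k * N) + N * N * S₀   ≡⟨ cong (λ z → a * N * z + N * N * S₀) eq₁ ⟩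
      a * N * (S₁ + r₁) + N * N * S₀     ∎
      where
      ring : ∀ a k N S → N * N * (k * a + S) + a * (N * N) ≡ a * N * (suc k * N) + N * N * S
      ring = solve-∀
    reduced : D * (N * a * M + b * b * S₁) ≤ D * (b * M * S₀) + 2 * (a * N) * ℓ
    reduced = +-cancelʳ-≤ (rest a b S₀ S₁ r₀ r₂ D + 2 * (a * N) * (D * r₁)) _ _ (begin
      D * (N * a * M + b * b * S₁) + (rest a b S₀ S₁ r₀ r₂ D + 2 * (a * N) * (D * r₁))
        ≡⟨ ring₁ a b S₀ S₁ r₀ r₁ r₂ D ⟩
      D * (a * a * (N + S₀ + S₁ + r₂) + (N * N * (S₁ + r₀) + a * (N * N))) + 2 * (a * N) * (D * r₁)
        ≤⟨ +-mono-≤ (*-monoʳ-≤ D (+-mono-≤ H (≤-reflexive E))) strides ⟩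
      D * (a * N * (S₁ + r₁) + (a * N * (S₁ + r₁) + N * N * S₀)) + (D * (r₂ * (a * a) + r₀ * (N * N)) + 2 * (a * N) * ℓ)
        ≡⟨ ring₂ a b S₀ S₁ r₀ r₁ r₂ D ℓ ⟩
      D * (b * M * S₀) + 2 * (a * N) * ℓ + (rest a b S₀ S₁ r₀ r₂ D + 2 * (a * N) * (D * r₁)) ∎)
      where
      rest : ℕ → ℕ → ℕ → ℕ → ℕ → ℕ → ℕ → ℕ
      rest a b S₀ S₁ r₀ r₂ D = D * (a * a * S₀ + 2 * (a * (a + b)) * S₁ + a * a * r₂ + (a + b) * (a + b) * r₀)
      ring₁ : ∀ a b S₀ S₁ r₀ r₁ r₂ D →
        D * ((a + b) * a * (a + b + a) + b * b * S₁) + (D * (a * a * S₀ + 2 * (a * (a + b)) * S₁ + a * a * r₂ + (a + b) * (a + b) * r₀) + 2 * (a * (a + b)) * (D * r₁))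
        ≡ D * (a * a * (a + b + S₀ + S₁ + r₂) + ((a + b) * (a + b) * (S₁ + r₀) + a * ((a + b) * (a + b)))) + 2 * (a * (a + b)) * (D * r₁)
      ring₁ = solve-∀
      ring₂ : ∀ a b S₀ S₁ r₀ r₁ r₂ D ℓ →
        D * (a * (a + b) * (S₁ + r₁) + (a * (a + b) * (S₁ + r₁) + (a + b) * (a + b) * S₀)) + (D * (r₂ * (a * a) + r₀ * ((a + b) * (a + b))) + 2 * (a * (a + b)) * ℓ)
        ≡ D * (b * (a + b + a) * S₀) + 2 * (a * (a + b)) * ℓ + (D * (a * a * S₀ + 2 * (a * (a + b)) * S₁ + a * a * r₂ + (a + b) * (a + b) * r₀) + 2 * (a * (a + b)) * (D * r₁))
      ring₂ = solve-∀
    combined : D * (12 * (N * N * a)) ≤ 48 * (a * N * ℓ) + D * (N * (b * b))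
    combined = +-cancelʳ-≤ (D * (24 * (b * M * S₀))) _ _ (begin
      D * (12 * (N * N * a)) + D * (24 * (b * M * S₀))                         ≡⟨ sym (*-distribˡ-+ D (12 * (N * N * a)) _) ⟩
      D * (12 * (N * N * a) + 24 * (b * M * S₀))                               ≤⟨ *-monoʳ-≤ D (moment-form a b S₀ S₁ N>0 moments) ⟩
      D * (24 * (N * a * M) + 24 * (b * b * S₁) + N * (b * b))                 ≡⟨ ring₁ D (N * a * M) (b * b * S₁) (N * (b * b)) ⟩
      24 * (D * (N * a * M + b * b * S₁)) + D * (N * (b * b))                  ≤⟨ +-monoˡ-≤ (D * (N * (b * b))) (*-monoʳ-≤ 24 reduced) ⟩
      24 * (D * (b * M * S₀) + 2 * (a * N) * ℓ) + D * (N * (b * b))            ≡⟨ ring₂ D (b * M * S₀) (a * N) ℓ (N * (b * b)) ⟩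
      48 * (a * N * ℓ) + D * (N * (b * b)) + D * (24 * (b * M * S₀))           ∎)
      where
      ring₁ : ∀ D x y z → D * (24 * x + 24 * y + z) ≡ 24 * (D * (x + y)) + D * z
      ring₁ = solve-∀
      ring₂ : ∀ D x c ℓ z → 24 * (D * x + 2 * c * ℓ) + D * z ≡ 48 * (c * ℓ) + D * z + D * (24 * x)
      ring₂ = solve-∀
    -- With b ≤ a the remainder Nb² is at most 1/24 of 12aN², which turns the threshold 1/4 for
    -- ℓ/(ND) into 23/96.
    2b²≤Na : 2 * (b * b) ≤ N * a
    2b²≤Na = begin
      2 * (b * b)   ≡⟨ ring b ⟩
      (b + b) * b   ≤⟨ *-mono-≤ (+-monoˡ-≤ b b≤a) b≤a ⟩
      N * a         ∎
      where
      ring : ∀ b → 2 * (b * b) ≡ (b + b) * b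
      ring = solve-∀
    large : 23 * (N * D) ≤ 96 * ℓ
    large = *-cancelˡ-≤ (a * N) {{>-nonZero (*-mono-< a>0 N>0)}} (+-cancelʳ-≤ (D * (N * (N * a))) _ _ (begin
      a * N * (23 * (N * D)) + D * (N * (N * a))            ≡⟨ ring₁ a N D ⟩
      2 * (D * (12 * (N * N * a)))                          ≤⟨ *-monoʳ-≤ 2 combined ⟩
      2 * (48 * (a * N * ℓ) + D * (N * (b * b)))            ≡⟨ ring₂ (a * N) ℓ D N (b * b) ⟩
      a * N * (96 * ℓ) + D * (N * (2 * (b * b)))            ≤⟨ +-monoʳ-≤ (a * N * (96 * ℓ)) (*-monoʳ-≤ D (*-monoʳ-≤ N 2b²≤Na)) ⟩
      a * N * (96 * ℓ) + D * (N * (N * a))                  ∎))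
      where
      ring₁ : ∀ a N D → a * N * (23 * (N * D)) + D * (N * (N * a)) ≡ 2 * (D * (12 * (N * N * a)))
      ring₁ = solve-∀
      ring₂ : ∀ c ℓ D N x → 2 * (48 * (c * ℓ) + D * (N * x)) ≡ c * (96 * ℓ) + D * (N * (2 * x))
      ring₂ = solve-∀
    impossible : ⊥
    impossible = <⇒≱ small large

-- The induction step

-- Marks Q(0), at y = m + 2 = 2. There the loss should be D p(0), but V 0 = 0 because e(0) = 0; this
-- indicator supplies the difference.
is-two : ℕ → ℕ
is-two 2 = 1
is-two _ = 0

is-two≤1 : ∀ y → is-two y ≤ 1
is-two≤1 0 = z≤n
is-two≤1 1 = z≤n
is-two≤1 2 = ≤-refl
is-two≤1 (suc (suc (suc y))) = z≤n

-- The constants 30, 200 and 80 are a choice for which all these estimates hold from about 1400 on.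
record Threshold (n₀ : ℕ) : Set where
  field
    ratio-constants : ∀ t → n₀ ≤ t → ∃ λ C → 0 < C × 30 * (t * 2 + 1) ≡ 2 * (t + 200 + 30) + C ×
      30 * 30 * ((t * 6 + 80 * 80) * (t * 2 + 1)) ≤ 4 * 81 * (C * (t + 200))
    squares-constants : ∀ t → n₀ ≤ t → ∃ λ C → 30 * (t * 2 + 3) ≡ 4 * (t + 200 + 30) + C ×
      48 * (t + 200 + 30) ≤ C + 24 * 30
    final-constants : ∀ t → n₀ ≤ t →
      960 * (27 * 30 * (t * (t * 2 + 1)) + 60 * (suc t * (t + 200))) ≤ 227 * (30 * 60 * ((t * 2 + 1) * (t * 2 + 1)))
    prefix-large : ∀ t → n₀ ≤ t → fourth (t * 6 + 80 * 80) ≤ ∑ t p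
    ratio-initial : ∀ i → 6 ≤ i → i < n₀ →
      (i + 200 + 30) * ((suc i * 2 + 1) * p i) ≤ (suc i + 200) * ((i * 2 + 1) * p (suc i))

module Step {n₀ : ℕ} (threshold : Threshold n₀) (m : ℕ) (n₀≤n : n₀ ≤ suc m) (2≤n₀ : 2 ≤ n₀)
            (log-convex-below : ∀ i → i < m → LogConvexAt i) where

  open Threshold threshold
  open ≤-Reasoning

  n k M D a N b c : ℕ
  n = suc m
  k = suc n
  M = suc k
  D = (n * 2 + 1) !
  a = p m
  N = p n
  b = increment m
  c = 2 * (a * N)

  1≤m : 1 ≤ m
  1≤m = ≤-pred (≤-trans 2≤n₀ n₀≤n)

  N≡a+b : N ≡ a + b
  N≡a+b = help m 1≤m
    where
    help : ∀ m → 1 ≤ m → p (suc m) ≡ p m + increment m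
    help (suc m) _ = p-suc m

  b≤a : b ≤ a
  b≤a = help m 1≤m
    where
    help : ∀ m → 1 ≤ m → increment m ≤ p m
    help (suc m) _ = increment≤p m

  D>0 : 0 < D
  D>0 = n!≢0′ (n * 2 + 1)
    where
    n!≢0′ : ∀ n → 0 < n !
    n!≢0′ zero    = s≤s z≤n
    n!≢0′ (suc n) = *-mono-< {0} {suc n} {0} (s≤s z≤n) (n!≢0′ n)

  V : ℕ → ℕ
  V t = D / suc (t * 2) * e t

  V-zero : V 0 ≡ 0
  V-zero = *-zeroʳ (D / 1)

  V-spec : ∀ t → t ≤ n → (t * 2 + 1) * V t ≡ D * e t
  V-spec t t≤n = begin-equality
    (t * 2 + 1) * (D / suc (t * 2) * e t)   ≡⟨ cong (_* V t) (+-comm (t * 2) 1) ⟩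
    suc (t * 2) * (D / suc (t * 2) * e t)   ≡⟨ sym (*-assoc (suc (t * 2)) (D / suc (t * 2)) (e t)) ⟩
    suc (t * 2) * (D / suc (t * 2)) * e t   ≡⟨ cong (_* e t) (m*[n/m]≡n divides) ⟩
    D * e t                                 ∎
    where
    divides : suc (t * 2) ∣ D
    divides = ∣-trans (m∣m*n {suc (t * 2)} ((t * 2) !))
      (m≤n⇒m!∣n! (≤-trans (s≤s (*-monoˡ-≤ 2 t≤n)) (≤-reflexive (+-comm 1 (n * 2)))))

  open WeightedSums n D V V-zero V-spec
  open Ratio 30 200

  ratio : ∀ t → t ≤ n → Ratio t
  ratio = <-rec (λ t → t ≤ n → Ratio t) step
    where
    step : ∀ t → (∀ {s} → s < t → s ≤ n → Ratio s) → t ≤ n → Ratio t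
    step t rec t≤n with t ≤? 6
    -- Monotonicity of V alone suffices while 30t ≤ t + 200, that is up to 6; hence the bound 6 in
    -- the table check.
    ... | yes t≤6 = ratio-small t t≤n (≤-trans (*-monoʳ-≤ 30 t≤6) (≤-trans (≤ᵇ⇒≤ 180 200 _) (m≤n+m 200 t)))
    step zero    rec t≤n | no t≰6 = contradiction z≤n t≰6
    step (suc t) rec t≤n | no t≰6 with t <? n₀
    ... | yes t<n₀ = ratio-suc t t≤n (≤-trans (s≤s z≤n) 6≤t) (ratio-initial t 6≤t t<n₀) (rec ≤-refl (<⇒≤ t≤n))
      where
      6≤t : 6 ≤ t
      6≤t = ≤-pred (≰⇒> t≰6)
    ... | no  t≮n₀ with ratio-constants (suc t) (m≤n⇒m≤1+n (≮⇒≥ t≮n₀))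
    -- `prefix-bound` with l = 80 is the tangent to the square-root bound at 6t + 1 = 81², so it is
    -- sharpest near t = 1093, not far below the threshold.
    ...   | C , C>0 , splitting , numeric = ratio-large (suc t) (4 * 81) (suc t * 6 + 80 * 80) C t≤n (s≤s z≤n) C>0 splitting
      (≤-trans (*-monoˡ-≤ (4 * 81) (∑-mono (suc t) (λ s _ → e≤p s)))
               (prefix-bound 80 (suc t) (≤-trans 2≤n₀ (m≤n⇒m≤1+n (≮⇒≥ t≮n₀)))))
      numeric (λ s s<t → rec s<t (≤-trans (<⇒≤ s<t) t≤n))

  open LongStrides ratio k (≤-trans (n≤1+n n) (n≤1+n k)) hiding (M)

  960Λ≤227DN : 960 * Λ ≤ 227 * (D * N)
  960Λ≤227DN = *-cancelˡ-≤ (30 * 60 * (A * A)) {{>-nonZero (*-mono-< {0} {30 * 60} (s≤s z≤n) (*-mono-< A>0 A>0))}} (begin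
    30 * 60 * (A * A) * (960 * Λ)        ≡⟨ ring₁ (30 * 60) A 960 Λ ⟩
    960 * (30 * 60 * (A * (A * Λ)))      ≤⟨ *-monoʳ-≤ 960 (Λ-bound (s≤s z≤n) (squares-bound (proj₁ sq) (s≤s z≤n) (proj₁ (proj₂ sq)) (proj₂ (proj₂ sq)))) ⟩
    960 * (X * (D * N))                  ≡⟨ sym (*-assoc 960 X (D * N)) ⟩
    960 * X * (D * N)                    ≤⟨ *-monoˡ-≤ (D * N) (final-constants n n₀≤n) ⟩
    227 * (30 * 60 * (A * A)) * (D * N)  ≡⟨ ring₂ 227 (30 * 60 * (A * A)) (D * N) ⟩
    30 * 60 * (A * A) * (227 * (D * N))  ∎)
    where
    A X : ℕ
    A = n * 2 + 1
    X = 27 * 30 * (n * (n * 2 + 1)) + 60 * (suc n * (n + 200))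
    A>0 : 0 < A
    A>0 = m≤n+m 1 (n * 2)
    sq = squares-constants n n₀≤n
    ring₁ : ∀ q A c x → q * (A * A) * (c * x) ≡ c * (q * (A * (A * x)))
    ring₁ = solve-∀
    ring₂ : ∀ a b c → a * b * c ≡ b * (a * c)
    ring₂ = solve-∀

  σ : ℕ
  σ = ∑ k (λ i → ∑ M (λ j → suc j * is-two (2 + n ∸ (2 + i) * suc j)))

  -- A nonzero term has (2 + i)(j + 1) = n, hence j + 1 ≤ n. Such a crude cubic bound is enough,
  -- since N exceeds a multiple of (6n + 80²)³.
  σ≤ : σ ≤ k * (M * n)
  σ≤ = ≤-trans (∑-mono k (λ i _ → ≤-trans (∑-mono M (λ j _ → term i j)) (≤-reflexive (∑-const M n)))) (≤-reflexive (∑-const k (M * n)))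
    where
    term : ∀ i j → suc j * is-two (2 + n ∸ (2 + i) * suc j) ≤ n
    term i j with suc j ≤? n
    ... | yes j<n = ≤-trans (*-mono-≤ j<n (is-two≤1 (2 + n ∸ (2 + i) * suc j))) (≤-reflexive (*-identityʳ n))
    ... | no  j≮n = ≤-trans (≤-reflexive (trans (cong (suc j *_) (zero-at (≤-trans (∸-monoʳ-≤ (2 + n) big) (≤-reflexive (m+n∸n≡m 1 n))))) (*-zeroʳ (suc j)))) z≤n
      where
      big : suc n ≤ (2 + i) * suc j
      big = ≤-trans (≰⇒> j≮n) (m≤n*m (suc j) (2 + i))
      zero-at : ∀ {y} → y ≤ 1 → is-two y ≡ 0
      zero-at {zero}        _         = refl
      zero-at {suc zero}    _         = refl
      zero-at {suc (suc y)} (s≤s ())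

  480σ≤N : 480 * σ ≤ N
  480σ≤N = *-cancelˡ-≤ y {{>-nonZero y>0}} (begin
    y * (480 * σ)                          ≤⟨ *-monoʳ-≤ y (*-monoʳ-≤ 480 σ≤) ⟩
    y * (480 * (k * (M * n)))              ≡⟨ ring₁ y k M n 80 ⟩
    y * (k * (M * (n * 6))) * 80           ≤⟨ *-mono-≤ (*-monoʳ-≤ y (*-mono-≤ k≤y (*-mono-≤ M≤y (m≤m+n (n * 6) (80 * 80))))) (≤ᵇ⇒≤ 80 (4 * 81) _) ⟩
    y * (y * (y * y)) * (4 * 81)           ≡⟨ cong (_* (4 * 81)) (ring₂ y) ⟩
    fourth y * (4 * 81)                    ≤⟨ *-monoˡ-≤ (4 * 81) (prefix-large n n₀≤n) ⟩
    ∑ n p * (4 * 81)                       ≤⟨ prefix-bound 80 n (≤-trans 2≤n₀ n₀≤n) ⟩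
    y * N                                  ∎)
    where
    y : ℕ
    y = n * 6 + 80 * 80
    y>0 : 0 < y
    y>0 = <-≤-trans (s≤s z≤n) (m≤n+m (80 * 80) (n * 6))
    M≤y : M ≤ y
    M≤y = ≤-trans (+-mono-≤ (≤ᵇ⇒≤ 2 (80 * 80) _) (m≤m*n n 6)) (≤-reflexive (+-comm (80 * 80) (n * 6)))
    k≤y : k ≤ y
    k≤y = ≤-trans (n≤1+n k) M≤y
    ring₁ : ∀ y k M n c → y * ((6 * c) * (k * (M * n))) ≡ y * (k * (M * (n * 6))) * c
    ring₁ = solve-∀
    ring₂ : ∀ y → y * (y * (y * y)) ≡ (y * y) * (y * y)
    ring₂ = solve-∀

  ℓ : ℕ
  ℓ = Λ + D * σ

  -- The budget 23/96 = 230/960 is split into 227 for Λ, 2 for σ and 1 for strictness.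
  96ℓ<23ND : 96 * ℓ < 23 * (N * D)
  96ℓ<23ND = *-cancelˡ-< 10 _ _ (begin-strict
    10 * (96 * ℓ)                          ≡⟨ ring₁ Λ D σ ⟩
    960 * Λ + D * (2 * (480 * σ))          ≤⟨ +-mono-≤ 960Λ≤227DN (*-monoʳ-≤ D (*-monoʳ-≤ 2 480σ≤N)) ⟩
    227 * (D * N) + D * (2 * N)            <⟨ m<m+n _ (*-mono-< D>0 (p>0 n)) ⟩
    227 * (D * N) + D * (2 * N) + D * N    ≡⟨ ring₂ D N ⟩
    10 * (23 * (N * D))                    ∎)
    where
    ring₁ : ∀ Λ D σ → 10 * (96 * (Λ + D * σ)) ≡ 960 * Λ + D * (2 * (480 * σ))
    ring₁ = solve-∀
    ring₂ : ∀ D N → 227 * (D * N) + D * (2 * N) + D * N ≡ 10 * (23 * (N * D))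
    ring₂ = solve-∀

  -- The lower bound for D Q(y - 2). For y < 2 the subtracted term vanishes, for y = 2 the indicator
  -- pays for it, and otherwise `discriminant` applies to the induction hypothesis. Strides of at
  -- least 2 give y = n + 2 - ij ≤ n, which keeps the hypothesis in range.
  form-bound : ∀ y → y ≤ n →
    c * (D * shift p (y ∸ 1)) ≤ D * (shift p y * (a * a) + shift p (y ∸ 2) * (N * N)) + c * (V (y ∸ 2) + D * is-two y)
  form-bound 0 _ = ≤-trans (≤-reflexive (trans (cong (c *_) (*-zeroʳ D)) (*-zeroʳ c))) z≤n
  form-bound 1 _ = ≤-trans (≤-reflexive (trans (cong (c *_) (*-zeroʳ D)) (*-zeroʳ c))) z≤n
  form-bound 2 _ = ≤-trans (*-monoʳ-≤ c (m≤n+m (D * 1) (V 0))) (m≤n+m (c * (V 0 + D * 1)) (D * (shift p 2 * (a * a) + 0)))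
  form-bound (suc (suc (suc i))) y≤n = *-cancelˡ-≤ A {{>-nonZero (m≤n+m 1 (t * 2))}} (begin
    A * (c * (D * p t))                           ≡⟨ ring₁ t a N D (p t) ⟩
    D * (4 * t * (a * N * p t)) + c * (D * p t)   ≤⟨ +-monoˡ-≤ (c * (D * p t)) (*-monoʳ-≤ D (discriminant t (p i) (p t) (p (suc t)) a N (<⇒≤ (log-convex-below i (≤-pred (<⇒≤ y≤n)))))) ⟩
    D * (A * F) + c * (D * p t)                   ≡⟨ cong (λ z → D * (A * F) + c * z) (sym (V-spec t (≤-trans (n≤1+n t) (<⇒≤ y≤n)))) ⟩
    D * (A * F) + c * (A * V t)                   ≡⟨ ring₂ D A F c (V t) ⟩
    A * (D * F + c * (V t + 0))                   ≡⟨ cong (λ z → A * (D * F + c * (V t + z))) (sym (*-zeroʳ D)) ⟩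
    A * (D * F + c * (V t + D * 0))               ∎)
    where
    t A F : ℕ
    t = suc i
    A = t * 2 + 1
    F = p (suc t) * (a * a) + p i * (N * N)
    ring₁ : ∀ t a N D x → (t * 2 + 1) * (2 * (a * N) * (D * x)) ≡ D * (4 * t * (a * N * x)) + 2 * (a * N) * (D * x)
    ring₁ = solve-∀
    ring₂ : ∀ D A F c v → D * (A * F) + c * (A * v) ≡ A * (D * F + c * (v + 0))
    ring₂ = solve-∀

  contribution : ℕ → ℕ → ℕ
  contribution x d = ∑ M (λ j → suc j * shift p (x ∸ d * suc j))

  r : ℕ → ℕ
  r x = ∑ k (λ i → contribution x (2 + i))

  divisor-sum-split : ∀ x → suc x ≤ M → x * p x ≡ ∑∑ p x + r (suc x)
  divisor-sum-split x x<M = trans (divisor-sum-identity M x x<M)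
    (trans (∑-head k (λ i → contribution (suc x) (suc i)))
           (cong (_+ r (suc x)) (trans (unit-stride M (suc x) (shift p) refl x<M) (∑∑-shift p x))))

  stride-bound : ∀ i → c * (D * contribution (suc n) (2 + i)) ≤
    D * (contribution (2 + n) (2 + i) * (a * a) + contribution n (2 + i) * (N * N))
      + c * (strided V (2 + i) + D * ∑ M (λ j → suc j * is-two (2 + n ∸ (2 + i) * suc j)))
  stride-bound i = begin
    c * (D * contribution (suc n) d)
      ≡⟨ trans (cong (c *_) (sym (∑-* D M _))) (sym (∑-* c M _)) ⟩
    ∑ M (λ j → c * (D * (suc j * shift p (suc n ∸ d * suc j))))
      ≤⟨ ∑-mono M (λ j _ → term j) ⟩
    ∑ M (λ j → D * (x₂ j * (a * a) + x₀ j * (N * N)) + c * (v j + D * w j))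
      ≡⟨ trans (∑-+ M _ _) (cong₂ _+_ (∑-* D M _) (∑-* c M _)) ⟩
    D * ∑ M (λ j → x₂ j * (a * a) + x₀ j * (N * N)) + c * ∑ M (λ j → v j + D * w j)
      ≡⟨ cong₂ (λ u u′ → D * u + c * u′)
           (trans (∑-+ M _ _) (cong₂ _+_ (∑-*ʳ (a * a) x₂) (∑-*ʳ (N * N) x₀)))
           (trans (∑-+ M _ _) (cong (∑ M v +_) (∑-* D M w))) ⟩
    D * (∑ M x₂ * (a * a) + ∑ M x₀ * (N * N)) + c * (∑ M v + D * ∑ M w) ∎
    where
    d : ℕ
    d = 2 + i
    x₂ x₀ v w : ℕ → ℕ
    x₂ j = suc j * shift p (2 + n ∸ d * suc j)
    x₀ j = suc j * shift p (n ∸ d * suc j)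
    v j = suc j * V (n ∸ d * suc j)
    w j = suc j * is-two (2 + n ∸ d * suc j)
    ∑-*ʳ : ∀ q f → ∑ M (λ j → f j * q) ≡ ∑ M f * q
    ∑-*ʳ q f = trans (∑-cong M (λ j _ → *-comm (f j) q)) (trans (∑-* q M f) (*-comm q (∑ M f)))
    ring₁ : ∀ c D j x → c * (D * (j * x)) ≡ j * (c * (D * x))
    ring₁ = solve-∀
    ring₂ : ∀ j D x q y q′ c u D′ z → j * (D * (x * q + y * q′) + c * (u + D′ * z)) ≡ D * (j * x * q + j * y * q′) + c * (j * u + D′ * (j * z))
    ring₂ = solve-∀
    term : ∀ j → c * (D * (suc j * shift p (suc n ∸ d * suc j))) ≤ D * (x₂ j * (a * a) + x₀ j * (N * N)) + c * (v j + D * w j)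
    term j = begin
      c * (D * (suc j * shift p (suc n ∸ d * suc j)))
        ≡⟨ ring₁ c D (suc j) _ ⟩
      suc j * (c * (D * shift p (suc n ∸ d * suc j)))
        ≡⟨ cong (λ z → suc j * (c * (D * shift p z))) (sym (∸-swap (2 + n) (d * suc j) 1)) ⟩
      suc j * (c * (D * shift p (y ∸ 1)))
        ≤⟨ *-monoʳ-≤ (suc j) (form-bound y (≤-trans (∸-monoʳ-≤ (2 + n) (≤-trans (m≤m+n 2 i) (m≤m*n d (suc j)))) ≤-refl)) ⟩
      suc j * (D * (shift p y * (a * a) + shift p (y ∸ 2) * (N * N)) + c * (V (y ∸ 2) + D * is-two y))
        ≡⟨ cong (λ z → suc j * (D * (shift p y * (a * a) + shift p z * (N * N)) + c * (V z + D * is-two y))) (∸-swap (2 + n) (d * suc j) 2) ⟩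
      suc j * (D * (shift p y * (a * a) + shift p (n ∸ d * suc j) * (N * N)) + c * (V (n ∸ d * suc j) + D * is-two y))
        ≡⟨ ring₂ (suc j) D (shift p y) (a * a) (shift p (n ∸ d * suc j)) (N * N) c (V (n ∸ d * suc j)) D (is-two y) ⟩
      D * (x₂ j * (a * a) + x₀ j * (N * N)) + c * (v j + D * w j) ∎
      where
      y : ℕ
      y = 2 + n ∸ d * suc j

  strides-bound : c * (D * r (suc n)) ≤ D * (r (2 + n) * (a * a) + r n * (N * N)) + c * ℓ
  strides-bound = begin
    c * (D * r (suc n))
      ≡⟨ trans (cong (c *_) (sym (∑-* D k _))) (sym (∑-* c k _)) ⟩
    ∑ k (λ i → c * (D * contribution (suc n) (2 + i)))
      ≤⟨ ∑-mono k (λ i _ → stride-bound i) ⟩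
    ∑ k (λ i → D * (x₂ i * (a * a) + x₀ i * (N * N)) + c * (v i + D * w i))
      ≡⟨ trans (∑-+ k _ _) (cong₂ _+_ (∑-* D k _) (∑-* c k _)) ⟩
    D * ∑ k (λ i → x₂ i * (a * a) + x₀ i * (N * N)) + c * ∑ k (λ i → v i + D * w i)
      ≡⟨ cong₂ (λ u u′ → D * u + c * u′)
           (trans (∑-+ k _ _) (cong₂ _+_ (∑-*ʳ (a * a) x₂) (∑-*ʳ (N * N) x₀)))
           (trans (∑-+ k _ _) (cong (∑ k v +_) (∑-* D k w))) ⟩
    D * (r (2 + n) * (a * a) + r n * (N * N)) + c * ℓ ∎
    where
    x₂ x₀ v w : ℕ → ℕ
    x₂ i = contribution (2 + n) (2 + i)
    x₀ i = contribution n (2 + i)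
    v i = strided V (2 + i)
    w i = ∑ M (λ j → suc j * is-two (2 + n ∸ (2 + i) * suc j))
    ∑-*ʳ : ∀ q f → ∑ k (λ j → f j * q) ≡ ∑ k f * q
    ∑-*ʳ q f = trans (∑-cong k (λ j _ → *-comm (f j) q)) (trans (∑-* q k f) (*-comm q (∑ k f)))

  log-convex : LogConvexAt m
  log-convex = subst (λ z → suc m * (z * z) < a * (suc n * p (suc n))) (sym N≡a+b)
    (assemble m a b (∑ n p) (∑∑ p n) (r n) (r (suc n)) (r (2 + n)) D ℓ (suc n * p (suc n)) (p>0 m) b≤a
      (trans (cong (suc m *_) (sym N≡a+b)) (divisor-sum-split n (n≤1+n k)))
      (trans (cong (_+ ∑ n p) (divisor-sum-split m (≤-trans (n≤1+n n) (n≤1+n k)))) (ring₁ (∑∑ p m) (r n) (∑ n p)))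
      (trans (divisor-sum-split (suc n) ≤-refl) (trans (cong (λ z → ∑∑ p n + (∑ n p + z) + r (2 + n)) N≡a+b) (ring₂ (∑∑ p n) (∑ n p) (a + b) (r (2 + n)))))
      (subst (λ z → 2 * (a * z) * (D * r (suc n)) ≤ D * (r (2 + n) * (a * a) + r n * (z * z)) + 2 * (a * z) * ℓ) N≡a+b strides-bound)
      (subst (λ z → (2 * ∑ n p + z) ² ≤ z * (6 * ∑∑ p n + z)) N≡a+b (p-moments n (≤-trans 2≤n₀ n₀≤n)))
      (subst (λ z → 96 * ℓ < 23 * (z * D)) N≡a+b 96ℓ<23ND))
    where
    ring₁ : ∀ f r s → f + r + s ≡ f + s + r
    ring₁ = solve-∀
    ring₂ : ∀ f s N r → f + (s + N) + r ≡ N + s + f + r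
    ring₂ = solve-∀

-- Verification of the threshold and conclusion

+1400 : ∀ t → 1400 ≤ t → ∃ λ x → x + 1400 ≡ t
+1400 t 1400≤t = t ∸ 1400 , m∸n+n≡m 1400≤t

unit-linear : ∀ x c d → x + c + d ≡ x * 1 + (c + d)
unit-linear = solve-∀

growth-from : ∀ l c → 90 ≤ 4 * suc l → 1 ≤ c → fourth (suc c * 6 + l * l) ≤ p c →
  ∀ x → fourth ((x + suc c) * 6 + l * l) ≤ ∑ (x + suc c) p
growth-from l c 90≤ 1≤c large = prefix-growth l (suc c) 90≤ (s≤s 1≤c) (≤-trans large (m≤n+m (p c) (∑ c p)))

threshold : Threshold 1400
threshold = record
  { ratio-constants   = λ t 1400≤t → ratio-constants (+1400 t 1400≤t)
  ; squares-constants = λ t 1400≤t → squares-constants (+1400 t 1400≤t)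
  ; final-constants   = λ t 1400≤t → final-constants (+1400 t 1400≤t)
  ; prefix-large      = λ t 1400≤t → subst (λ z → fourth (z * 6 + 80 * 80) ≤ ∑ z p) (m∸n+n≡m 1400≤t)
      (growth-from 80 1399 (≤ᵇ⇒≤ 90 324 _) (s≤s z≤n) (large-value 1399 ≤-refl (≤ᵇ⇒≤ 1000 1399 _)) (t ∸ 1400))
  ; ratio-initial     = λ i 6≤i i<1400 → ratio-small-values i i<1400 6≤i
  }
  where
  ratio-constants : ∀ {t} → (∃ λ x → x + 1400 ≡ t) → ∃ λ C → 0 < C × 30 * (t * 2 + 1) ≡ 2 * (t + 200 + 30) + C ×
    30 * 30 * ((t * 6 + 80 * 80) * (t * 2 + 1)) ≤ 4 * 81 * (C * (t + 200))
  -- C = 58t - 430 at t = x + 1400. Writing 1400 = 1392 + 8 makes the constant 8 · 58 - 430 = 34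
  -- nonnegative, so that the identity holds over ℕ with 1392 as a variable.
  ratio-constants (x , refl) = x * 58 + (1392 * 58 + 34) , <-≤-trans (s≤s z≤n) (m≤n+m (1392 * 58 + 34) (x * 58)) , ring x 1392 ,
    subst₂ (λ u v → 30 * 30 * u ≤ 4 * 81 * ((x * 58 + (1392 * 58 + 34)) * v))
      (cong₂ _*_ (sym (linear x 1400 6 (80 * 80))) (sym (linear x 1400 2 1))) (sym (unit-linear x 1400 200))
      (quadratic-≤ (30 * 30) 6 (1400 * 6 + 80 * 80) 2 (1400 * 2 + 1) (4 * 81) 58 (1392 * 58 + 34) 1 (1400 + 200) x
        (≤ᵇ⇒≤ (900 * (14800 * 2801)) (324 * (80770 * 1600)) _)
        (≤ᵇ⇒≤ (900 * (6 * 2801 + 14800 * 2)) (324 * (58 * 1600 + 80770 * 1)) _)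
        (≤ᵇ⇒≤ (900 * (6 * 2)) (324 * (58 * 1)) _))
    where
    ring : ∀ x c → 30 * ((x + (c + 8)) * 2 + 1) ≡ 2 * (x + (c + 8) + 200 + 30) + (x * 58 + (c * 58 + 34))
    ring = solve-∀
  squares-constants : ∀ {t} → (∃ λ x → x + 1400 ≡ t) → ∃ λ C → 30 * (t * 2 + 3) ≡ 4 * (t + 200 + 30) + C ×
    48 * (t + 200 + 30) ≤ C + 24 * 30
  -- Likewise C = 56t - 830, with 1400 = 1385 + 15 and 15 · 56 - 830 = 10.
  squares-constants (x , refl) = x * 56 + (1385 * 56 + 10) , ring x 1385 , ≤-trans (≤-reflexive (ring′ x 1400))
    (≤-trans (+-mono-≤ (*-monoʳ-≤ x (≤ᵇ⇒≤ 48 56 _)) (≤ᵇ⇒≤ (48 * (1400 + 200 + 30)) (1385 * 56 + 10 + 24 * 30) _))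
             (≤-reflexive (sym (+-assoc (x * 56) (1385 * 56 + 10) (24 * 30)))))
    where
    ring : ∀ x c → 30 * ((x + (c + 15)) * 2 + 3) ≡ 4 * (x + (c + 15) + 200 + 30) + (x * 56 + (c * 56 + 10))
    ring = solve-∀
    ring′ : ∀ x c → 48 * (x + c + 200 + 30) ≡ x * 48 + 48 * (c + 200 + 30)
    ring′ = solve-∀
  final-constants : ∀ {t} → (∃ λ x → x + 1400 ≡ t) →
    960 * (27 * 30 * (t * (t * 2 + 1)) + 60 * (suc t * (t + 200))) ≤ 227 * (30 * 60 * ((t * 2 + 1) * (t * 2 + 1)))
  -- From 2t ≤ 2t + 1 the first term costs 960 · 810 / 2 = 388800 of the available 227 · 1800 =
  -- 408600 multiples of (2t + 1)²; 19600 of the rest cover the second term, whose leading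
  -- coefficients satisfy 57600 ≤ 4 · 19600.
  final-constants {t} (x , x+1400≡t) = combine 960 (27 * 30) 60 388800 19600 227 (30 * 60) t (t * 2 + 1) (suc t * (t + 200))
    refl (≤ᵇ⇒≤ (388800 + 19600) (227 * (30 * 60)) _) (m≤m+n (t * 2) 1)
    (subst (λ t → 960 * 60 * (suc t * (t + 200)) ≤ 19600 * ((t * 2 + 1) * (t * 2 + 1))) x+1400≡t
      (subst₂ (λ u v → 960 * 60 * u ≤ 19600 * (v * v))
        (cong₂ _*_ (trans (sym (unit-linear x 1400 1)) (+-comm (x + 1400) 1)) (sym (unit-linear x 1400 200))) (sym (linear x 1400 2 1))
        (quadratic-≤ (960 * 60) 1 (1400 + 1) 1 (1400 + 200) 19600 2 (1400 * 2 + 1) 2 (1400 * 2 + 1) x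
          (≤ᵇ⇒≤ (57600 * (1401 * 1600)) (19600 * (2801 * 2801)) _)
          (≤ᵇ⇒≤ (57600 * (1 * 1600 + 1401 * 1)) (19600 * (2 * 2801 + 2801 * 2)) _)
          (≤ᵇ⇒≤ (57600 * (1 * 1)) (19600 * (2 * 2)) _))))
    where
    open ≤-Reasoning
    combine : ∀ k a b h g q s t A Y → k * a ≡ h * 2 → h + g ≤ q * s → t * 2 ≤ A → k * b * Y ≤ g * (A * A) →
      k * (a * (t * A) + b * Y) ≤ q * (s * (A * A))
    combine k a b h g q s t A Y ka≡2h h+g≤qs 2t≤A second = begin
      k * (a * (t * A) + b * Y)         ≡⟨ ring₁ k a b (t * A) Y ⟩
      k * a * (t * A) + k * b * Y       ≡⟨ cong (λ z → z * (t * A) + k * b * Y) ka≡2h ⟩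
      h * 2 * (t * A) + k * b * Y       ≡⟨ cong (_+ k * b * Y) (ring₂ h t A) ⟩
      h * (t * 2 * A) + k * b * Y       ≤⟨ +-mono-≤ (*-monoʳ-≤ h (*-monoˡ-≤ A 2t≤A)) second ⟩
      h * (A * A) + g * (A * A)         ≡⟨ sym (*-distribʳ-+ (A * A) h g) ⟩
      (h + g) * (A * A)                 ≤⟨ *-monoˡ-≤ (A * A) h+g≤qs ⟩
      q * s * (A * A)                   ≡⟨ *-assoc q s (A * A) ⟩
      q * (s * (A * A))                 ∎
      where
      ring₁ : ∀ k a b x y → k * (a * x + b * y) ≡ k * a * x + k * b * y
      ring₁ = solve-∀
      ring₂ : ∀ k t A → k * 2 * (t * A) ≡ k * (t * 2 * A)
      ring₂ = solve-∀

p-log-convex : ∀ m → LogConvexAt m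
p-log-convex = <-rec LogConvexAt step
  where
  step : ∀ m → (∀ {i} → i < m → LogConvexAt i) → LogConvexAt m
  step m rec with m <? 1400
  ... | yes m<1400 = log-convex-small m m<1400
  ... | no  m≮1400 = Step.log-convex threshold m (m≤n⇒m≤1+n (≮⇒≥ m≮1400)) (s≤s (s≤s z≤n)) (λ i i<m → rec i<m)

theorem4p1 : ∀ (n : ℕ) → n > 1 →
    n * (p n * p n) < p (n ∸ 1) * (suc n * p (suc n))
theorem4p1 (suc m) _ = p-log-convex m
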